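{- Let $z\in\mathbb{N}$, $z\ge 1$. Then the integrality gap of the semidefinite program $\mathrm{SDP}_2$ (the symmetry-reduced QAP relaxation of the traveling salesman problem defined in the context) is at least $z$; that is, $$\sup_{D\in\mathcal{D}} \frac{\mathrm{OPT}_{\mathrm{TSP}}(D)}{\mathrm{OPT}_{\mathrm{SDP}_2}(D)}\ \ge\ z .$$
   Context: TSP: an instance on $N$ vertices is a symmetric matrix $D=(d_{ij})\in\mathbb{R}^{N\times N}$ with $d_{ij}\ge 0$, $d_{ii}=0$ and $d_{ij}\le d_{ik}+d_{kj}$ for all $i,j,k$ (distinct vertices may be at distance $0$). $\mathcal{D}$ is the set of all such matrices, over all $N\ge 3$. $\mathrm{OPT}_{\mathrm{TSP}}(D)$ is the minimum total cost of a Hamiltonian cycle in the complete graph $K_N$ with edge costs $d_{ij}$. Notation: $[m]=\{1,\dots,m\}$; $I_m$, $J_m$ are the $m\times m$ identity and all-ones matrices; $E^{(m)}_{jj}$ is the $m\times m$ matrix with a single $1$ in position $(j,j)$; $\mathbb{S}^{m\times m}$ is the set of real symmetric $m\times m$ matrices; $M[S,T]$ is the submatrix of $M$ with rows in $S$ and columns in $T$, and $M[S]=M[S,S]$; $\mathrm{Diag}(x)$ is the diagonal matrix with diagonal $x$; $\mathrm{vec}(M)$ stacks the columns of $M$; $\otimes$ is the Kronecker product; $Y\ge 0$ is entrywise nonnegativity and $Y\succeq 0$ is positive semidefiniteness. $C^{(N)}_1$ is the adjacency matrix of the $N$-cycle on $[N]$ with edges $\{i,i+1\}$ and $\{N,1\}$.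 $\mathrm{SDP}_2$: for an $N$-vertex instance $D$, put $n=N-1$, fix $r,s\in[n+1]$, and let $\alpha=[n+1]\setminus\{r\}$, $\beta=[n+1]\setminus\{s\}$, $\bar c=\mathrm{vec}\big(C^{(n+1)}_1[\alpha,\{r\}]\,D[\{s\},\beta]\big)\in\mathbb{R}^{n^2}$. Then $\mathrm{OPT}_{\mathrm{SDP}_2}(D)$ is the minimum of $$\mathrm{trace}\Big(\big(D[\beta]\otimes \tfrac12 C^{(n+1)}_1[\alpha]+\mathrm{Diag}(\bar c)\big)Y\Big)$$ over $Y\in\mathbb{S}^{n^2\times n^2}$ with $Y\ge 0$, $Y\succeq 0$ and (i) $\mathrm{trace}((I_n\otimes E^{(n)}_{jj})Y)=1$ for $j=1,\dots,n$; (ii) $\mathrm{trace}((E^{(n)}_{jj}\otimes I_n)Y)=1$ for $j=1,\dots,n$; (iii) $\mathrm{trace}\big((I_n\otimes(J_n-I_n)+(J_n-I_n)\otimes I_n)Y\big)=0$; (iv) $\mathrm{trace}((J_n\otimes J_n)Y)=n^2$. The choice of $r,s$ for each $N$ is arbitrary but fixed (one may take $r=s=1$). In the supremum, instances with $\mathrm{OPT}_{\mathrm{TSP}}(D)=0$ are disregarded, and a ratio with positive numerator and zero denominator is read as $+\infty$. -}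

module Defs where

open import Algebra.Bundles using (CommutativeRing)
import Algebra.Definitions.RawMonoid as RawMonoidDefs
open import Data.Bool.Base using (if_then_else_)
open import Data.Fin.Base using (Fin; toℕ; punchIn; quotient; remainder)
open import Data.Fin.Permutation using (Permutation′; _⟨$⟩ʳ_)
open import Data.Fin.Properties using (_≟_)
open import Data.Nat.Base as ℕ using (ℕ; suc)
open import Data.Nat.DivMod using (_mod_)
open import Data.Product.Base using (∃-syntax; _×_)
open import Data.Vec.Functional using (Vector)
open import Level using (0ℓ)
open import Relation.Binary.Core using (Rel)
open import Relation.Binary.Structures using (IsTotalOrder)
open import Relation.Nullary.Construct.Add.Supremum using (_⁺; [_]; ⊤⁺)
open import Relation.Nullary.Decidable using (⌊_⌋; _⊎-dec_)
open import Relation.Nullary.Negation using (¬_)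
import Relation.Binary.Construct.Add.Supremum.NonStrict as AddSupremum

module _ {A : Set} (_≤_ : Rel A 0ℓ) where

  IsUpperBound : (A → Set) → A → Set
  IsUpperBound P b = ∀ x → P x → x ≤ b

  IsSupremum : (A → Set) → A → Set
  IsSupremum P s = IsUpperBound P s × (∀ b → IsUpperBound P b → s ≤ b)

  IsMinimum : (A → Set) → A → Set
  IsMinimum P m = P m × (∀ x → P x → m ≤ x)

-- The textbook axioms of the real numbers, which determine them up to
-- isomorphism.  They are the classical ones: with excluded middle for Set,
-- Dedekind cuts ℚ → Bool form a model.
record CompleteOrderedField : Set₁ where
  field
    commutativeRing : CommutativeRing 0ℓ 0ℓ

  open CommutativeRing commutativeRing public

  infix 4 _≤_
  infix 8 _⁻¹

  field
    _≤_          : Rel Carrier 0ℓ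
    isTotalOrder : IsTotalOrder _≈_ _≤_
    +-monoˡ-≤    : ∀ {x y} z → x ≤ y → x + z ≤ y + z
    *-nonneg     : ∀ {x y} → 0# ≤ x → 0# ≤ y → 0# ≤ x * y
    0≉1          : ¬ 0# ≈ 1#
    -- The value of 0# ⁻¹ is unspecified.
    _⁻¹          : Carrier → Carrier
    ⁻¹-inverseʳ  : ∀ x → ¬ x ≈ 0# → x * x ⁻¹ ≈ 1#
    complete     : (P : Carrier → Set) →
                   (∃[ x ] P x) → (∃[ b ] IsUpperBound _≤_ P b) →
                   ∃[ s ] IsSupremum _≤_ P s

-- The vertex set [m] is Fin m, so that all indices are shifted down by one.
module TSP (ℝ : CompleteOrderedField) where

  open CompleteOrderedField ℝ
  open RawMonoidDefs +-rawMonoid public using (sum) renaming (_×_ to _×ℝ_)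

  fromℕ : ℕ → Carrier
  fromℕ k = k ×ℝ 1#

  ½ : Carrier
  ½ = fromℕ 2 ⁻¹

  Matrix : ℕ → ℕ → Set
  Matrix m n = Fin m → Fin n → Carrier

  infixl 6 _+ᴹ_ _-ᴹ_
  infixl 7 _*ᴹ_ _⊗_
  infixr 8 _*ˢ_

  _+ᴹ_ _-ᴹ_ : ∀ {m n} → Matrix m n → Matrix m n → Matrix m n
  (A +ᴹ B) i j = A i j + B i j
  (A -ᴹ B) i j = A i j - B i j

  _*ᴹ_ : ∀ {l m n} → Matrix l m → Matrix m n → Matrix l n
  (A *ᴹ B) i j = sum (λ k → A i k * B k j)

  _*ˢ_ : ∀ {m n} → Carrier → Matrix m n → Matrix m n
  (c *ˢ A) i j = c * A i j

  -- The index (i , p) of a Kronecker product is combine i p, that is, i n + p.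
  _⊗_ : ∀ {k l m n} → Matrix k l → Matrix m n → Matrix (k ℕ.* m) (l ℕ.* n)
  _⊗_ {k} {l} {m} {n} A B x y =
    A (quotient m x) (quotient n y) * B (remainder {k} m x) (remainder {l} n y)

  -- Column j of M occupies the indices combine j i, for i in Fin m.
  vec : ∀ {m n} → Matrix m n → Vector Carrier (n ℕ.* m)
  vec {m} {n} M x = M (remainder {n} m x) (quotient m x)

  trace : ∀ {n} → Matrix n n → Carrier
  trace A = sum (λ i → A i i)

  Diag : ∀ {n} → Vector Carrier n → Matrix n n
  Diag x i j = if ⌊ i ≟ j ⌋ then x i else 0#

  I J : ∀ n → Matrix n n
  I n = Diag (λ _ → 1#)
  J n _ _ = 1#

  E : ∀ {n} → Fin n → Matrix n n
  E j = Diag (λ i → if ⌊ i ≟ j ⌋ then 1# else 0#)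

  submatrix : ∀ {k l m n} → Matrix m n → (Fin k → Fin m) → (Fin l → Fin n) →
              Matrix k l
  submatrix M S T i j = M (S i) (T j)

  Symmetric : ∀ {n} → Matrix n n → Set
  Symmetric A = ∀ i j → A i j ≈ A j i

  Nonnegative : ∀ {m n} → Matrix m n → Set
  Nonnegative A = ∀ i j → 0# ≤ A i j

  PositiveSemidefinite : ∀ {n} → Matrix n n → Set
  PositiveSemidefinite {n} A = (x : Vector Carrier n) →
    0# ≤ sum (λ i → sum (λ j → x i * A i j * x j))

  record IsInstance {N} (D : Matrix N N) : Set where
    field
      symmetric   : Symmetric D
      nonnegative : Nonnegative D
      diagonal    : ∀ i → D i i ≈ 0#
      triangle    : ∀ i j k → D i j ≤ D i k + D k j

  next : ∀ {n} → Fin (suc n) → Fin (suc n)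
  next {n} i = suc (toℕ i) mod suc n

  -- A Hamiltonian cycle is given by an order σ 0, σ 1, … in which it visits
  -- the vertices.
  tourCost : ∀ {n} → Matrix (suc n) (suc n) → Permutation′ (suc n) → Carrier
  tourCost D σ = sum (λ i → D (σ ⟨$⟩ʳ i) (σ ⟨$⟩ʳ next i))

  IsOPT-TSP : ∀ {n} → Matrix (suc n) (suc n) → Carrier → Set
  IsOPT-TSP D = IsMinimum _≤_ (λ c → ∃[ σ ] tourCost D σ ≈ c)

  C₁ : ∀ n → Matrix (suc n) (suc n)
  C₁ n i j = if ⌊ next i ≟ j ⊎-dec next j ≟ i ⌋ then 1# else 0#

  module SDP₂ {n} (r s : Fin (suc n)) (D : Matrix (suc n) (suc n)) where

    α β : Fin n → Fin (suc n)
    α = punchIn r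
    β = punchIn s

    c̄ : Vector Carrier (n ℕ.* n)
    c̄ = vec {n} {n}
            (submatrix (C₁ n) α (λ (_ : Fin 1) → r)
             *ᴹ submatrix D (λ (_ : Fin 1) → s) β)

    objective : Matrix (n ℕ.* n) (n ℕ.* n) → Carrier
    objective Y =
      trace ((submatrix D β β ⊗ (½ *ˢ submatrix (C₁ n) α α) +ᴹ Diag c̄) *ᴹ Y)

    record Feasible (Y : Matrix (n ℕ.* n) (n ℕ.* n)) : Set where
      field
        symmetric            : Symmetric Y
        nonnegative          : Nonnegative Y
        positiveSemidefinite : PositiveSemidefinite Y
        trace-I⊗E            : (j : Fin n) → trace ((I n ⊗ E j) *ᴹ Y) ≈ 1#
        trace-E⊗I            : (j : Fin n) → trace ((E j ⊗ I n) *ᴹ Y) ≈ 1#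
        trace-gangster       : trace ((I n ⊗ (J n -ᴹ I n) +ᴹ (J n -ᴹ I n) ⊗ I n) *ᴹ Y)
                               ≈ 0#
        trace-J⊗J            : trace ((J n ⊗ J n) *ᴹ Y) ≈ fromℕ (n ℕ.* n)

    IsOPT : Carrier → Set
    IsOPT = IsMinimum _≤_ (λ c → ∃[ Y ] Feasible Y × objective Y ≈ c)

  open AddSupremum _≤_ public using (_≤⁺_)

  -- Carrier ⁺ adds +∞, written ⊤⁺, to ℝ.  IsRatio t v ρ says that ρ = t / v,
  -- where t / 0 = +∞; it is only used with t ≠ 0.
  IsRatio : Carrier → Carrier → Carrier ⁺ → Set
  IsRatio t v [ q ] = ¬ v ≈ 0# × q * v ≈ t
  IsRatio t v ⊤⁺    = v ≈ 0#

  -- r n and s n are the indices fixed for instances on N = n + 1 vertices.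
  module _ (r s : ∀ n → Fin (suc n)) where

    record InstanceRatio (ρ : Carrier ⁺) : Set where
      field
        n           : ℕ
        2≤n         : 2 ℕ.≤ n
        D           : Matrix (suc n) (suc n)
        isInstance  : IsInstance D
        opt-TSP     : Carrier
        isOPT-TSP   : IsOPT-TSP D opt-TSP
        opt-TSP≉0   : ¬ opt-TSP ≈ 0#
        opt-SDP₂    : Carrier
        isOPT-SDP₂  : SDP₂.IsOPT (r n) (s n) D opt-SDP₂
        isRatio     : IsRatio opt-TSP opt-SDP₂ ρ

    IsIntegralityGap : Carrier ⁺ → Set
    IsIntegralityGap = IsSupremum _≤⁺_ InstanceRatio

{-# OPTIONS --safe #-}

-- Take g groups of b vertices, add a vertex s to one of them, and set distance 0
-- inside a group and 1 otherwise.  A tour must leave every group, so it costs at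
-- least g.  Let G be the 0/1 matrix of the groups on the n = g b vertices other than s.
-- If M is an n × n matrix on the tour positions that shares with G the unit
-- diagonal, entries in [0 , 1], row sums b and the positive semidefiniteness of
-- n M − b J, then
--   Y = (I ⊗ I + (G − I) ⊗ (M − I) / (b − 1) + (J − G) ⊗ (J − M) / (n − b)) / n
-- is feasible, and its cost is at most 2 plus the sum of 1 − M over consecutive
-- positions.  For M take the Gram matrix of the cyclic translates of a hat
-- function of width 2 h = b, mixed with J so as to correct the row sums.  Because
-- the hat is Lipschitz, 1 − M is of order 1 / h² for consecutive positions, and
-- with g = h the cost of Y is at most 6.
--
-- The minimum over Y is attained because the feasible set is closed and bounded;
-- a limit point is found one entry at a time, as a limit inferior.
module Submission where

open import Defs
open import Algebra.Bundles using (CommutativeRing)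
import Algebra.Properties.Ring as RingProperties
import Algebra.Properties.Semiring.Mult as SemiringMult
import Algebra.Properties.Semiring.Mult.TCOptimised as Multiples
import Algebra.Properties.Semiring.Sum as SemiringSum
import Algebra.Solver.Ring as RingSolver
open import Algebra.Solver.Ring.AlmostCommutativeRing
  using (fromCommutativeRing; _-Raw-AlmostCommutative⟶_)
open import Axiom.ExcludedMiddle using (ExcludedMiddle)
open import Data.Bool.Base using (if_then_else_)
open import Data.Empty using (⊥; ⊥-elim)
open import Data.Fin.Base
  using (Fin; zero; suc; toℕ; fromℕ<; punchIn; combine; quotient; remainder; _↑ˡ_; _↑ʳ_)
import Data.Fin.Permutation as Permutation
open import Data.Fin.Permutation using (Permutation′; _⟨$⟩ʳ_; _⟨$⟩ˡ_; inverseʳ)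
open import Data.Fin.Properties
  using (_≟_; any?; toℕ<n; toℕ≤n; toℕ-injective; toℕ-fromℕ<; remQuot-combine)
open import Data.Integer.Base as ℤ using (ℤ; +_; -[1+_]; _⊖_)
import Data.Integer.Properties as ℤ
open import Data.Maybe.Base using (Maybe; just; nothing)
open import Data.Nat.Base as ℕ using (ℕ; zero; suc; NonZero)
open import Data.Nat.DivMod
  using (_%_; _mod_; m%n<n; m%n%n≡m%n; m<n⇒m%n≡m; n%n≡0; %-distribˡ-+; [m+n]%n≡m%n; [m+kn]%n≡m%n)
open import Data.Nat.Induction using (<-rec)
import Data.Nat.Properties as ℕ
open import Data.Product.Base using (∃; ∃-syntax; _×_; _,_; proj₁; proj₂)
import Data.Sum.Base as Sum
open import Data.Sum.Base using (_⊎_; inj₁; inj₂)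
open import Data.Vec.Functional using (Vector; _∷_; insertAt)
open import Data.Vec.Functional.Properties using (insertAt-punchIn)
open import Function.Base using (_∘_)
open import Level using (0ℓ)
open import Relation.Binary.Bundles using (Poset)
import Relation.Binary.Construct.Add.Supremum.NonStrict as AddSupremum
open import Relation.Binary.PropositionalEquality as ≡ using (_≡_; _≢_)
import Relation.Binary.Reasoning.PartialOrder as PosetReasoning
import Relation.Binary.Reasoning.Setoid as SetoidReasoning
open import Relation.Binary.Structures using (IsTotalOrder)
open import Relation.Nullary.Construct.Add.Supremum using (_⁺; [_]; ⊤⁺)
open import Relation.Nullary.Decidable
  using (Dec; yes; no; ⌊_⌋; ¬?; _×-dec_; _⊎-dec_; decidable-stable)
open import Relation.Nullary.Negation using (¬_)

-- The ring solver with integer coefficients, over which subtractions cancel.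
module IntegerCoefficients (R : CommutativeRing 0ℓ 0ℓ) where
  open CommutativeRing R
  open Multiples semiring renaming (_×_ to _×#_)
  open RingProperties ring
  open SetoidReasoning setoid

  ⟦_⟧ᶻ : ℤ → Carrier
  ⟦ + n ⟧ᶻ      = n ×# 1#
  ⟦ -[1+ n ] ⟧ᶻ = - (suc n ×# 1#)

  ⟦-⟧ᶻ : ∀ i → ⟦ ℤ.- i ⟧ᶻ ≈ - ⟦ i ⟧ᶻ
  ⟦-⟧ᶻ (+ zero)  = sym -0#≈0#
  ⟦-⟧ᶻ (+ suc n) = refl
  ⟦-⟧ᶻ -[1+ n ]  = sym (-‿involutive _)

  ⟦⊖⟧ᶻ : ∀ m n → ⟦ m ⊖ n ⟧ᶻ ≈ m ×# 1# - n ×# 1#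
  ⟦⊖⟧ᶻ zero    zero    = sym (-‿inverseʳ 0#)
  ⟦⊖⟧ᶻ zero    (suc n) = sym (+-identityˡ _)
  ⟦⊖⟧ᶻ (suc m) zero    = sym (trans (+-congˡ -0#≈0#) (+-identityʳ _))
  ⟦⊖⟧ᶻ (suc m) (suc n) = begin
    ⟦ suc m ⊖ suc n ⟧ᶻ                   ≡⟨ ≡.cong ⟦_⟧ᶻ (ℤ.[1+m]⊖[1+n]≡m⊖n m n) ⟩
    ⟦ m ⊖ n ⟧ᶻ                           ≈⟨ ⟦⊖⟧ᶻ m n ⟩
    m ×# 1# - n ×# 1#                      ≈⟨ +-congʳ (sym (trans (+-congʳ (-‿inverseˡ 1#)) (+-identityˡ _))) ⟩
    (- 1# + 1# + m ×# 1#) - n ×# 1#        ≈⟨ +-congʳ (trans (+-assoc _ _ _) (+-comm _ _)) ⟩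
    ((1# + m ×# 1#) - 1#) - n ×# 1#        ≈⟨ +-assoc _ _ _ ⟩
    (1# + m ×# 1#) + (- 1# - n ×# 1#)      ≈⟨ +-congˡ (-‿+-comm 1# (n ×# 1#)) ⟩
    (1# + m ×# 1#) - (1# + n ×# 1#)        ≈⟨ +-cong (sym (1+× m 1#)) (-‿cong (sym (1+× n 1#))) ⟩
    suc m ×# 1# - suc n ×# 1#              ∎

  ⟦+⟧ᶻ : ∀ i j → ⟦ i ℤ.+ j ⟧ᶻ ≈ ⟦ i ⟧ᶻ + ⟦ j ⟧ᶻ
  ⟦+⟧ᶻ (+ m)    (+ n)    = ×-homo-+ 1# m n
  ⟦+⟧ᶻ (+ m)    -[1+ n ] = ⟦⊖⟧ᶻ m (suc n)
  ⟦+⟧ᶻ -[1+ m ] (+ n)    = trans (⟦⊖⟧ᶻ n (suc m)) (+-comm _ _)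
  ⟦+⟧ᶻ -[1+ m ] -[1+ n ] = begin
    - (suc (suc (m ℕ.+ n)) ×# 1#)        ≡⟨ ≡.cong (λ k → - (k ×# 1#)) (≡.sym (ℕ.+-suc (suc m) n)) ⟩
    - ((suc m ℕ.+ suc n) ×# 1#)          ≈⟨ -‿cong (×-homo-+ 1# (suc m) (suc n)) ⟩
    - (suc m ×# 1# + suc n ×# 1#)         ≈⟨ sym (-‿+-comm _ _) ⟩
    - (suc m ×# 1#) - suc n ×# 1#         ∎

  ⟦+*⟧ᶻ : ∀ m j → ⟦ + m ℤ.* j ⟧ᶻ ≈ ⟦ + m ⟧ᶻ * ⟦ j ⟧ᶻ
  ⟦+*⟧ᶻ m (+ n)    = trans (reflexive (≡.cong ⟦_⟧ᶻ (≡.sym (ℤ.pos-* m n)))) (×1-homo-* m n)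
  ⟦+*⟧ᶻ m -[1+ n ] = begin
    ⟦ + m ℤ.* (ℤ.- (+ suc n)) ⟧ᶻ   ≡⟨ ≡.cong ⟦_⟧ᶻ (≡.sym (ℤ.neg-distribʳ-* (+ m) (+ suc n))) ⟩
    ⟦ ℤ.- (+ m ℤ.* + suc n) ⟧ᶻ     ≈⟨ ⟦-⟧ᶻ (+ m ℤ.* + suc n) ⟩
    - ⟦ + m ℤ.* + suc n ⟧ᶻ         ≈⟨ -‿cong (⟦+*⟧ᶻ m (+ suc n)) ⟩
    - (⟦ + m ⟧ᶻ * ⟦ + suc n ⟧ᶻ)    ≈⟨ -‿distribʳ-* _ _ ⟩
    ⟦ + m ⟧ᶻ * - ⟦ + suc n ⟧ᶻ      ∎

  ⟦*⟧ᶻ : ∀ i j → ⟦ i ℤ.* j ⟧ᶻ ≈ ⟦ i ⟧ᶻ * ⟦ j ⟧ᶻ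
  ⟦*⟧ᶻ (+ m)    j = ⟦+*⟧ᶻ m j
  ⟦*⟧ᶻ -[1+ m ] j = begin
    ⟦ (ℤ.- (+ suc m)) ℤ.* j ⟧ᶻ     ≡⟨ ≡.cong ⟦_⟧ᶻ (≡.sym (ℤ.neg-distribˡ-* (+ suc m) j)) ⟩
    ⟦ ℤ.- (+ suc m ℤ.* j) ⟧ᶻ       ≈⟨ ⟦-⟧ᶻ (+ suc m ℤ.* j) ⟩
    - ⟦ + suc m ℤ.* j ⟧ᶻ           ≈⟨ -‿cong (⟦+*⟧ᶻ (suc m) j) ⟩
    - (⟦ + suc m ⟧ᶻ * ⟦ j ⟧ᶻ)      ≈⟨ -‿distribˡ-* _ _ ⟩
    - ⟦ + suc m ⟧ᶻ * ⟦ j ⟧ᶻ        ∎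

  homomorphism : ℤ.+-*-rawRing -Raw-AlmostCommutative⟶ fromCommutativeRing R
  homomorphism = record
    { ⟦_⟧ = ⟦_⟧ᶻ ; +-homo = ⟦+⟧ᶻ ; *-homo = ⟦*⟧ᶻ ; -‿homo = ⟦-⟧ᶻ
    ; 0-homo = refl ; 1-homo = refl }

  coeff≟ : ∀ i j → Maybe (⟦ i ⟧ᶻ ≈ ⟦ j ⟧ᶻ)
  coeff≟ i j with i ℤ.≟ j
  ... | yes i≡j = just (reflexive (≡.cong ⟦_⟧ᶻ i≡j))
  ... | no  _   = nothing

  open RingSolver ℤ.+-*-rawRing (fromCommutativeRing R) homomorphism coeff≟ public
    using (solve; _:=_; _:+_; _:*_; _:-_; :-_; con; Polynomial)

-- Read `Y` as the pair marginals of a fictitious random tour: the entry at (i , p) and (j , q) is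
-- the probability that position p holds vertex i and position q holds vertex j. It depends on i and
-- j only through whether they are equal, share a group or neither, and M p q plays the probability
-- that positions p and q carry the same group. For a single tour M would be a 0/1 matrix. The
-- construction needs little more than its row sums and that n M - b J, the covariance of the group
-- indicators up to scale, is positive semidefinite, so M may decay gradually away from the
-- diagonal. How it decays matters: the Gram matrix of interval indicators of width b gives 1 - M =
-- 1 / b for consecutive positions, hence g = n / b around the cycle and no gap. A hat changes by
-- one interval minus another under a step, so 1 - M, proportional to the squared distance of
-- neighbouring hats, drops to second order. With n = 2 h² the positions contribute at most 4 and
-- the edges at the deleted position at most 2; this is the 6, and h = 6 z turns the tour bound h
-- into a ratio of at least z.

module Gap (ℝ : CompleteOrderedField) where

  open TSP ℝ
  open CompleteOrderedField ℝ hiding (zero)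
  open AddSupremum _≤_ using (_≤⊤⁺; [≤]-injective; ≤⁺-trans) renaming ([_] to [_]≤)
  open IntegerCoefficients commutativeRing
    using (solve; _:=_; _:+_; _:*_; _:-_; :-_; con; Polynomial)
  open RingProperties ring using (-0#≈0#)
  open SemiringMult semiring using (×-homo-+; ×1-homo-*)
  open SemiringSum semiring
    using (sum-cong-≋; sum-syntax; sum-remove; sum-replicate-zero;
           ∑-distrib-+; ∑-comm; *-distribˡ-sum; *-distribʳ-sum)

  -- Ordered fields

  module ≤ = IsTotalOrder isTotalOrder

  poset : Poset _ _ _
  poset = record { isPartialOrder = ≤.isPartialOrder }

  module ≤-Reasoning = PosetReasoning poset

  :0 :1 : ∀ {n} → Polynomial n
  :0 = con (+ 0)
  :1 = con (+ 1)

  +-mono-≤ : ∀ {w x y z} → w ≤ x → y ≤ z → w + y ≤ x + z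
  +-mono-≤ {w} {x} {y} {z} w≤x y≤z = begin
    w + y ≤⟨ +-monoˡ-≤ y w≤x ⟩
    x + y ≈⟨ +-comm x y ⟩
    y + x ≤⟨ +-monoˡ-≤ x y≤z ⟩
    z + x ≈⟨ +-comm z x ⟩
    x + z ∎
    where open ≤-Reasoning

  +-nonneg : ∀ {x y} → 0# ≤ x → 0# ≤ y → 0# ≤ x + y
  +-nonneg {x} {y} 0≤x 0≤y = ≤.trans (≤.reflexive (sym (+-identityˡ 0#))) (+-mono-≤ 0≤x 0≤y)

  ≤-by : ∀ {x y d} → 0# ≤ d → y ≈ x + d → x ≤ y
  ≤-by {x} {y} {d} 0≤d y≈x+d = begin
    x       ≈⟨ +-identityʳ x ⟨
    x + 0#  ≤⟨ +-mono-≤ ≤.refl 0≤d ⟩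
    x + d   ≈⟨ y≈x+d ⟨
    y       ∎
    where open ≤-Reasoning

  0≤y-x : ∀ {x y} → x ≤ y → 0# ≤ y - x
  0≤y-x {x} {y} x≤y = begin
    0#    ≈⟨ -‿inverseʳ x ⟨
    x - x ≤⟨ +-monoˡ-≤ (- x) x≤y ⟩
    y - x ∎
    where open ≤-Reasoning

  0≤y-x⇒x≤y : ∀ {x y} → 0# ≤ y - x → x ≤ y
  0≤y-x⇒x≤y {x} {y} 0≤y-x = ≤-by 0≤y-x (solve 2 (λ x y → y := x :+ (y :- x)) refl x y)

  *-monoʳ-≤ : ∀ {c x y} → 0# ≤ c → x ≤ y → c * x ≤ c * y
  *-monoʳ-≤ {c} {x} {y} 0≤c x≤y = ≤-by (*-nonneg 0≤c (0≤y-x x≤y))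
    (solve 3 (λ c x y → c :* y := c :* x :+ c :* (y :- x)) refl c x y)

  square-nonneg : ∀ x → 0# ≤ x * x
  square-nonneg x with ≤.total 0# x
  ... | inj₁ 0≤x = *-nonneg 0≤x 0≤x
  ... | inj₂ x≤0 = ≤.trans (*-nonneg 0≤-x 0≤-x)
    (≤.reflexive (solve 1 (λ x → (:0 :- x) :* (:0 :- x) := x :* x) refl x))
    where 0≤-x = 0≤y-x x≤0

  0≤1 : 0# ≤ 1#
  0≤1 = ≤.trans (square-nonneg 1#) (≤.reflexive (*-identityˡ 1#))

  infix 4 _<_
  -- As a negation, strictness is proved by refutation, and totality alone turns it into `_≤_`.
  _<_ : Carrier → Carrier → Set
  x < y = ¬ y ≤ x

  <⇒≤ : ∀ {x y} → x < y → x ≤ y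
  <⇒≤ {x} {y} x<y with ≤.total x y
  ... | inj₁ x≤y = x≤y
  ... | inj₂ y≤x = ⊥-elim (x<y y≤x)

  <⇒≉ : ∀ {x y} → x < y → ¬ y ≈ x
  <⇒≉ x<y y≈x = x<y (≤.reflexive y≈x)

  ≤∧≉⇒< : ∀ {x y} → x ≤ y → ¬ y ≈ x → x < y
  ≤∧≉⇒< x≤y y≉x y≤x = y≉x (≤.antisym y≤x x≤y)

  0<1 : 0# < 1#
  0<1 = ≤∧≉⇒< 0≤1 (0≉1 ∘ sym)

  <-≤-trans : ∀ {x y z} → x < y → y ≤ z → x < z
  <-≤-trans x<y y≤z z≤x = x<y (≤.trans y≤z z≤x)

  ⁻¹-inverseˡ : ∀ {x} → 0# < x → x ⁻¹ * x ≈ 1#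
  ⁻¹-inverseˡ {x} 0<x = trans (*-comm _ _) (⁻¹-inverseʳ x (<⇒≉ 0<x))

  -- The inverse equals x times the square of the inverse, a product of nonnegative factors, so its
  -- sign need not be split into cases.
  ⁻¹-nonneg : ∀ {x} → 0# < x → 0# ≤ x ⁻¹
  ⁻¹-nonneg {x} 0<x = begin
    0#                  ≤⟨ *-nonneg (<⇒≤ 0<x) (square-nonneg (x ⁻¹)) ⟩
    x * (x ⁻¹ * x ⁻¹)   ≈⟨ *-assoc x (x ⁻¹) (x ⁻¹) ⟨
    x * x ⁻¹ * x ⁻¹     ≈⟨ *-congʳ (⁻¹-inverseʳ x (<⇒≉ 0<x)) ⟩
    1# * x ⁻¹           ≈⟨ *-identityˡ _ ⟩
    x ⁻¹                ∎
    where open ≤-Reasoning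

  *-cancelˡ-≤ : ∀ {c x y} → 0# < c → c * x ≤ c * y → x ≤ y
  *-cancelˡ-≤ {c} {x} {y} 0<c cx≤cy = begin
    x              ≈⟨ c⁻¹[cz]≈z x ⟨
    c ⁻¹ * (c * x) ≤⟨ *-monoʳ-≤ (⁻¹-nonneg 0<c) cx≤cy ⟩
    c ⁻¹ * (c * y) ≈⟨ c⁻¹[cz]≈z y ⟩
    y              ∎
    where
    open ≤-Reasoning
    c⁻¹[cz]≈z : ∀ z → c ⁻¹ * (c * z) ≈ z
    c⁻¹[cz]≈z z = trans (sym (*-assoc _ _ _)) (trans (*-congʳ (⁻¹-inverseˡ 0<c)) (*-identityˡ z))

  +-pos : ∀ {x y} → 0# < x → 0# ≤ y → 0# < x + y
  +-pos {x} {y} 0<x 0≤y = <-≤-trans 0<x (≤-by 0≤y refl)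

  *-pos : ∀ {x y} → 0# < x → 0# < y → 0# < x * y
  *-pos {x} {y} 0<x 0<y xy≤0 = 0<y (*-cancelˡ-≤ 0<x (≤.trans xy≤0 (≤.reflexive (sym (zeroʳ x)))))

  ⁻¹-pos : ∀ {x} → 0# < x → 0# < x ⁻¹
  ⁻¹-pos {x} 0<x x⁻¹≤0 = 0<1 (begin
    1#        ≈⟨ ⁻¹-inverseʳ x (<⇒≉ 0<x) ⟨
    x * x ⁻¹  ≤⟨ *-monoʳ-≤ (<⇒≤ 0<x) x⁻¹≤0 ⟩
    x * 0#    ≈⟨ zeroʳ x ⟩
    0#        ∎)
    where open ≤-Reasoning

  fromℕ-+ : ∀ m n → fromℕ (m ℕ.+ n) ≈ fromℕ m + fromℕ n
  fromℕ-+ m n = ×-homo-+ 1# m n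

  fromℕ-* : ∀ m n → fromℕ (m ℕ.* n) ≈ fromℕ m * fromℕ n
  fromℕ-* = ×1-homo-*

  fromℕ-nonneg : ∀ n → 0# ≤ fromℕ n
  fromℕ-nonneg zero    = ≤.refl
  fromℕ-nonneg (suc n) = +-nonneg 0≤1 (fromℕ-nonneg n)

  fromℕ-pos : ∀ {n} → 1 ℕ.≤ n → 0# < fromℕ n
  fromℕ-pos {suc n} _ = +-pos 0<1 (fromℕ-nonneg n)

  fromℕ-mono-≤ : ∀ {m n} → m ℕ.≤ n → fromℕ m ≤ fromℕ n
  fromℕ-mono-≤ {m} {n} m≤n = ≤-by (fromℕ-nonneg (n ℕ.∸ m))
    (trans (reflexive (≡.cong fromℕ (≡.sym (ℕ.m+[n∸m]≡n m≤n)))) (fromℕ-+ m (n ℕ.∸ m)))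

  2# : Carrier
  2# = 1# + 1#

  0<2 : 0# < 2#
  0<2 = +-pos 0<1 0≤1

  fromℕ2≈2 : fromℕ 2 ≈ 2#
  fromℕ2≈2 = +-congˡ (+-identityʳ 1#)

  ½*2≈1 : ½ * 2# ≈ 1#
  ½*2≈1 = trans (*-congˡ (sym fromℕ2≈2)) (⁻¹-inverseˡ (fromℕ-pos {2} (ℕ.s≤s ℕ.z≤n)))

  ½-nonneg : 0# ≤ ½
  ½-nonneg = ⁻¹-nonneg (fromℕ-pos {2} (ℕ.s≤s ℕ.z≤n))

  -- Finite sums

  ∑-cong : ∀ {n} {f g : Vector Carrier n} → (∀ i → f i ≈ g i) → sum f ≈ sum g
  ∑-cong = sum-cong-≋

  ∑-zero : ∀ {n} {f : Vector Carrier n} → (∀ i → f i ≈ 0#) → sum f ≈ 0#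
  ∑-zero {n} f≈0 = trans (∑-cong f≈0) (sum-replicate-zero n)

  ∑-neg : ∀ {n} (f : Vector Carrier n) → ∑[ i < n ] (- f i) ≈ - sum f
  ∑-neg {zero}  f = sym -0#≈0#
  ∑-neg {suc n} f = trans (+-congˡ (∑-neg (f ∘ suc)))
    (solve 2 (λ x y → :- x :+ :- y := :- (x :+ y)) refl (f zero) (sum (f ∘ suc)))

  ∑-distrib-- : ∀ {n} (f g : Vector Carrier n) → ∑[ i < n ] (f i - g i) ≈ sum f - sum g
  ∑-distrib-- f g = trans (∑-distrib-+ f (λ i → - g i)) (+-congˡ (∑-neg g))

  ∑-const : ∀ n x → ∑[ i < n ] x ≈ fromℕ n * x
  ∑-const zero    x = sym (zeroˡ x)
  ∑-const (suc n) x = trans (+-congˡ (∑-const n x))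
    (solve 2 (λ n x → x :+ n :* x := (:1 :+ n) :* x) refl (fromℕ n) x)

  ∑-mono-≤ : ∀ {n} {f g : Vector Carrier n} → (∀ i → f i ≤ g i) → sum f ≤ sum g
  ∑-mono-≤ {zero}  f≤g = ≤.refl
  ∑-mono-≤ {suc n} f≤g = +-mono-≤ (f≤g zero) (∑-mono-≤ (f≤g ∘ suc))

  ∑-nonneg : ∀ {n} {f : Vector Carrier n} → (∀ i → 0# ≤ f i) → 0# ≤ sum f
  ∑-nonneg {n} 0≤f = ≤.trans (≤.reflexive (sym (∑-zero {n} (λ _ → refl)))) (∑-mono-≤ 0≤f)

  term≤∑ : ∀ {n} {f : Vector Carrier n} → (∀ i → 0# ≤ f i) → ∀ i → f i ≤ sum f
  term≤∑ {suc n} 0≤f zero    = ≤-by (∑-nonneg (0≤f ∘ suc)) refl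
  term≤∑ {suc n} 0≤f (suc i) = ≤.trans (term≤∑ (0≤f ∘ suc) i) (≤-by (0≤f zero) (+-comm _ _))

  ∑-*ˡ : ∀ {n} c (f : Vector Carrier n) → ∑[ i < n ] (c * f i) ≈ c * sum f
  ∑-*ˡ c f = sym (*-distribˡ-sum c f)

  ∑-*ʳ : ∀ {n} (f : Vector Carrier n) c → ∑[ i < n ] (f i * c) ≈ sum f * c
  ∑-*ʳ f c = sym (*-distribʳ-sum c f)

  ∑∑-* : ∀ {m n} (f : Vector Carrier m) (g : Vector Carrier n) →
         ∑[ i < m ] ∑[ j < n ] (f i * g j) ≈ sum f * sum g
  ∑∑-* f g = trans (∑-cong (λ i → ∑-*ˡ (f i) g)) (∑-*ʳ f (sum g))

  ∑-++ : ∀ m {n} (f : Vector Carrier (m ℕ.+ n)) →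
         sum f ≈ ∑[ i < m ] f (i ↑ˡ n) + ∑[ j < n ] f (m ↑ʳ j)
  ∑-++ zero    f = sym (+-identityˡ _)
  ∑-++ (suc m) f = trans (+-congˡ (∑-++ m (f ∘ suc))) (sym (+-assoc _ _ _))

  ∑-combine : ∀ m n (f : Vector Carrier (m ℕ.* n)) →
              sum f ≈ ∑[ i < m ] ∑[ j < n ] f (combine i j)
  ∑-combine zero    n f = refl
  ∑-combine (suc m) n f = trans (∑-++ n f) (+-congˡ (∑-combine m n (f ∘ (n ↑ʳ_))))

  ∑-remQuot : ∀ m n (f : Fin m → Fin n → Carrier) →
              ∑[ x < m ℕ.* n ] f (quotient n x) (remainder {m} n x) ≈ ∑[ i < m ] ∑[ j < n ] f i j
  ∑-remQuot m n f = trans (∑-combine m n _) (∑-cong λ i → ∑-cong λ j →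
    reflexive (≡.cong (λ ij → f (proj₁ ij) (proj₂ ij)) (remQuot-combine i j)))

  -- Indicators of decidable propositions

  𝟙 : ∀ {P : Set} → Dec P → Carrier
  𝟙 P? = if ⌊ P? ⌋ then 1# else 0#

  𝟙-yes : ∀ {P : Set} (P? : Dec P) → P → 𝟙 P? ≡ 1#
  𝟙-yes (yes _)  p = ≡.refl
  𝟙-yes (no ¬p)  p = ⊥-elim (¬p p)

  𝟙-no : ∀ {P : Set} (P? : Dec P) → ¬ P → 𝟙 P? ≡ 0#
  𝟙-no (yes p) ¬p = ⊥-elim (¬p p)
  𝟙-no (no _)  ¬p = ≡.refl

  𝟙-nonneg : ∀ {P : Set} (P? : Dec P) → 0# ≤ 𝟙 P?
  𝟙-nonneg (yes _) = 0≤1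
  𝟙-nonneg (no _)  = ≤.refl

  𝟙-≤1 : ∀ {P : Set} (P? : Dec P) → 𝟙 P? ≤ 1#
  𝟙-≤1 (yes _) = ≤.refl
  𝟙-≤1 (no _)  = 0≤1

  𝟙-idem : ∀ {P : Set} (P? : Dec P) → 𝟙 P? * 𝟙 P? ≈ 𝟙 P?
  𝟙-idem (yes _) = *-identityˡ 1#
  𝟙-idem (no _)  = zeroˡ 0#

  𝟙-cong : ∀ {P Q : Set} (P? : Dec P) (Q? : Dec Q) → (P → Q) → (Q → P) → 𝟙 P? ≡ 𝟙 Q?
  𝟙-cong (yes p) Q? P⇒Q Q⇒P = ≡.sym (𝟙-yes Q? (P⇒Q p))
  𝟙-cong (no ¬p) Q? P⇒Q Q⇒P = ≡.sym (𝟙-no Q? (¬p ∘ Q⇒P))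

  𝟙-mono : ∀ {P Q : Set} (P? : Dec P) (Q? : Dec Q) → (P → Q) → 𝟙 P? ≤ 𝟙 Q?
  𝟙-mono (yes p) Q? P⇒Q = ≤.reflexive (reflexive (≡.sym (𝟙-yes Q? (P⇒Q p))))
  𝟙-mono (no ¬p) Q? P⇒Q = 𝟙-nonneg Q?

  ∑-𝟙 : ∀ {n} (j : Fin n) (f : Vector Carrier n) → ∑[ i < n ] (𝟙 (i ≟ j) * f i) ≈ f j
  ∑-𝟙 {suc n} zero f = trans (+-cong (*-identityˡ _) (∑-zero λ i → zeroˡ (f (suc i)))) (+-identityʳ _)
  ∑-𝟙 {suc n} (suc j) f = trans (+-cong (zeroˡ _)
    (trans (∑-cong λ i → *-congʳ (reflexive (𝟙-cong (suc i ≟ suc j) (i ≟ j) (λ { ≡.refl → ≡.refl }) (≡.cong suc))))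
           (∑-𝟙 j (f ∘ suc)))) (+-identityˡ _)

  ∑-𝟙≈1 : ∀ {n} (j : Fin n) → ∑[ i < n ] 𝟙 (i ≟ j) ≈ 1#
  ∑-𝟙≈1 j = trans (∑-cong λ i → sym (*-identityʳ (𝟙 (i ≟ j)))) (∑-𝟙 j (λ _ → 1#))

  ≟-sym : ∀ {n} (i j : Fin n) → 𝟙 (i ≟ j) ≡ 𝟙 (j ≟ i)
  ≟-sym i j = 𝟙-cong (i ≟ j) (j ≟ i) ≡.sym ≡.sym

  ∑-𝟙′ : ∀ {n} (j : Fin n) (f : Vector Carrier n) → ∑[ i < n ] (𝟙 (j ≟ i) * f i) ≈ f j
  ∑-𝟙′ j f = trans (∑-cong λ i → *-congʳ (reflexive (≟-sym j i))) (∑-𝟙 j f)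

  -- Traces and Gram matrices

  ∑∑-distrib-+ : ∀ {m n} (f g : Fin m → Fin n → Carrier) →
    ∑[ i < m ] ∑[ j < n ] (f i j + g i j) ≈ ∑[ i < m ] ∑[ j < n ] f i j + ∑[ i < m ] ∑[ j < n ] g i j
  ∑∑-distrib-+ f g = trans (∑-cong λ i → ∑-distrib-+ (f i) (g i)) (∑-distrib-+ (λ i → sum (f i)) (λ i → sum (g i)))

  ∑∑-*ˡ : ∀ {m n} c (f : Fin m → Fin n → Carrier) →
    ∑[ i < m ] ∑[ j < n ] (c * f i j) ≈ c * ∑[ i < m ] ∑[ j < n ] f i j
  ∑∑-*ˡ c f = trans (∑-cong λ i → ∑-*ˡ c (f i)) (∑-*ˡ c (λ i → sum (f i)))

  ∑∑-distrib-- : ∀ {m n} (f g : Fin m → Fin n → Carrier) →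
    ∑[ i < m ] ∑[ j < n ] (f i j - g i j) ≈ ∑[ i < m ] ∑[ j < n ] f i j - ∑[ i < m ] ∑[ j < n ] g i j
  ∑∑-distrib-- f g = trans (∑-cong λ i → ∑-distrib-- (f i) (g i)) (∑-distrib-- (λ i → sum (f i)) (λ i → sum (g i)))

  ∑∑-expand : ∀ {m n} (f f′ g g′ : Fin m → Fin n → Carrier) →
    ∑[ i < m ] ∑[ j < n ] ((f i j + f′ i j) - (g i j + g′ i j)) ≈
    (∑[ i < m ] ∑[ j < n ] f i j + ∑[ i < m ] ∑[ j < n ] f′ i j) -
    (∑[ i < m ] ∑[ j < n ] g i j + ∑[ i < m ] ∑[ j < n ] g′ i j)
  ∑∑-expand f f′ g g′ = trans (∑∑-distrib-- (λ i j → f i j + f′ i j) (λ i j → g i j + g′ i j))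
    (+-cong (∑∑-distrib-+ f f′) (-‿cong (∑∑-distrib-+ g g′)))

  -- The mixed-product rule together with multiplicativity of the trace. It reduces the trace
  -- constraints on `Y` to traces of n × n matrices.
  trace-⊗ : ∀ {m n} (A C : Matrix m m) (B D : Matrix n n) →
            trace ((A ⊗ B) *ᴹ (C ⊗ D)) ≈ trace (A *ᴹ C) * trace (B *ᴹ D)
  trace-⊗ {m} {n} A C B D = begin
    trace ((A ⊗ B) *ᴹ (C ⊗ D))
      ≈⟨ (∑-cong λ x → ∑-remQuot m n λ k q →
           A (quotient n x) k * B (remainder {m} n x) q * (C k (quotient n x) * D q (remainder {m} n x))) ⟩
    ∑[ x < m ℕ.* n ] ∑[ k < m ] ∑[ q < n ]
      (A (quotient n x) k * B (remainder {m} n x) q * (C k (quotient n x) * D q (remainder {m} n x)))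
      ≈⟨ (∑-remQuot m n λ i p → ∑[ k < m ] ∑[ q < n ] (A i k * B p q * (C k i * D q p))) ⟩
    ∑[ i < m ] ∑[ p < n ] ∑[ k < m ] ∑[ q < n ] (A i k * B p q * (C k i * D q p))
      ≈⟨ (∑-cong λ i → ∑-cong λ p → trans (∑-cong λ k → ∑-cong λ q →
           solve 4 (λ a b c d → a :* b :* (c :* d) := a :* c :* (b :* d)) refl (A i k) (B p q) (C k i) (D q p))
           (∑∑-* (λ k → A i k * C k i) (λ q → B p q * D q p))) ⟩
    ∑[ i < m ] ∑[ p < n ] ((A *ᴹ C) i i * (B *ᴹ D) p p)
      ≈⟨ ∑∑-* (λ i → (A *ᴹ C) i i) (λ p → (B *ᴹ D) p p) ⟩
    trace (A *ᴹ C) * trace (B *ᴹ D) ∎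
    where open SetoidReasoning setoid

  trace-+ˡ : ∀ {n} (A B C : Matrix n n) → trace ((A +ᴹ B) *ᴹ C) ≈ trace (A *ᴹ C) + trace (B *ᴹ C)
  trace-+ˡ A B C = trans
    (∑-cong λ i → ∑-cong λ k → distribʳ (C k i) (A i k) (B i k))
    (∑∑-distrib-+ (λ i k → A i k * C k i) (λ i k → B i k * C k i))

  trace-+ʳ : ∀ {n} (A B C : Matrix n n) → trace (A *ᴹ (B +ᴹ C)) ≈ trace (A *ᴹ B) + trace (A *ᴹ C)
  trace-+ʳ A B C = trans
    (∑-cong λ i → ∑-cong λ k → distribˡ (A i k) (B k i) (C k i))
    (∑∑-distrib-+ (λ i k → A i k * B k i) (λ i k → A i k * C k i))

  trace-*ˢʳ : ∀ {n} c (A B : Matrix n n) → trace (A *ᴹ (c *ˢ B)) ≈ c * trace (A *ᴹ B)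
  trace-*ˢʳ c A B = trans
    (∑-cong λ i → ∑-cong λ k → x∙yz≈y∙xz (A i k) c (B k i))
    (∑∑-*ˡ c (λ i k → A i k * B k i))
    where
    x∙yz≈y∙xz : ∀ x y z → x * (y * z) ≈ y * (x * z)
    x∙yz≈y∙xz = solve 3 (λ x y z → x :* (y :* z) := y :* (x :* z)) refl

  trace-Diag : ∀ {n} (d : Vector Carrier n) (A : Matrix n n) →
               trace (Diag d *ᴹ A) ≈ ∑[ i < n ] (d i * A i i)
  trace-Diag {n} d A = ∑-cong λ i → trans
    (∑-cong λ k → trans (*-congʳ (Diag-𝟙 i k)) (*-assoc _ _ _))
    (∑-𝟙′ i (λ k → d i * A k i))
    where
    Diag-𝟙 : ∀ i k → Diag d i k ≈ 𝟙 (i ≟ k) * d i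
    Diag-𝟙 i k with i ≟ k
    ... | yes _ = sym (*-identityˡ _)
    ... | no _  = sym (zeroˡ _)

  -- The cone generated by the matrices u uᵀ.
  data Gram {n : ℕ} : Matrix n n → Set where
    outer  : (u : Vector Carrier n) → Gram (λ i j → u i * u j)
    zero   : Gram (λ i j → 0#)
    _+ᴳ_   : ∀ {A B} → Gram A → Gram B → Gram (λ i j → A i j + B i j)
    scale  : ∀ {c A} → 0# ≤ c → Gram A → Gram (λ i j → c * A i j)
    ≈-resp : ∀ {A B} → (∀ i j → A i j ≈ B i j) → Gram A → Gram B

  infixl 6 _+ᴳ_

  quadraticForm : ∀ {n} → Matrix n n → Vector Carrier n → Carrier
  quadraticForm A x = sum (λ i → sum (λ j → x i * A i j * x j))

  Gram⇒PSD : ∀ {n} {A : Matrix n n} → Gram A → PositiveSemidefinite A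
  Gram⇒PSD {n} (outer u) x = begin
    0#                                        ≤⟨ square-nonneg _ ⟩
    (∑[ i < n ] (x i * u i)) * (∑[ i < n ] (x i * u i))
                                              ≈⟨ ∑∑-* (λ i → x i * u i) (λ i → x i * u i) ⟨
    ∑[ i < n ] ∑[ j < n ] (x i * u i * (x j * u j))
      ≈⟨ (∑-cong λ i → ∑-cong λ j →
           solve 4 (λ x u y v → x :* u :* (y :* v) := x :* (u :* v) :* y) refl (x i) (u i) (x j) (u j)) ⟩
    quadraticForm (λ i j → u i * u j) x       ∎
    where open ≤-Reasoning
  Gram⇒PSD zero x = ≤.reflexive (sym (∑-zero λ i → ∑-zero λ j → trans (*-congʳ (zeroʳ (x i))) (zeroˡ (x j))))
  Gram⇒PSD {n} (_+ᴳ_ {A} {B} a b) x = begin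
    0#                                        ≤⟨ +-nonneg (Gram⇒PSD a x) (Gram⇒PSD b x) ⟩
    quadraticForm A x + quadraticForm B x     ≈⟨ ∑∑-distrib-+ (λ i j → x i * A i j * x j) (λ i j → x i * B i j * x j) ⟨
    ∑[ i < n ] ∑[ j < n ] (x i * A i j * x j + x i * B i j * x j)
      ≈⟨ (∑-cong λ i → ∑-cong λ j →
           solve 4 (λ x a b y → x :* a :* y :+ x :* b :* y := x :* (a :+ b) :* y) refl (x i) (A i j) (B i j) (x j)) ⟩
    quadraticForm (λ i j → A i j + B i j) x   ∎
    where open ≤-Reasoning
  Gram⇒PSD {n} (scale {c} {A} 0≤c a) x = begin
    0#                                        ≤⟨ *-nonneg 0≤c (Gram⇒PSD a x) ⟩
    c * quadraticForm A x                     ≈⟨ ∑∑-*ˡ c (λ i j → x i * A i j * x j) ⟨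
    ∑[ i < n ] ∑[ j < n ] (c * (x i * A i j * x j))
      ≈⟨ (∑-cong λ i → ∑-cong λ j →
           solve 4 (λ c x a y → c :* (x :* a :* y) := x :* (c :* a) :* y) refl c (x i) (A i j) (x j)) ⟩
    quadraticForm (λ i j → c * A i j) x       ∎
    where open ≤-Reasoning
  Gram⇒PSD (≈-resp A≈B a) x =
    ≤.trans (Gram⇒PSD a x) (≤.reflexive (∑-cong λ i → ∑-cong λ j → *-congʳ (*-congˡ (A≈B i j))))

  Gram-∑ : ∀ {k n} {A : Fin k → Matrix n n} → (∀ x → Gram (A x)) → Gram (λ i j → ∑[ x < k ] A x i j)
  Gram-∑ {zero}  a = zero
  Gram-∑ {suc k} a = a zero +ᴳ Gram-∑ (a ∘ suc)

  -- The Kronecker product of u uᵀ and v vᵀ is w wᵀ for w = u ⊗ v, and the rest is bilinearity, by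
  -- recursion on the first derivation and then on the second. From quadratic forms alone this
  -- closure would call for a factorisation; it is the reason for working with `Gram`.
  Gram-⊗ : ∀ {m n} {A : Matrix m m} {B : Matrix n n} → Gram A → Gram B → Gram (A ⊗ B)
  Gram-⊗ {m} {n} (outer u) (outer v) =
    ≈-resp (λ x y → solve 4 (λ a b c d → a :* b :* (c :* d) := a :* c :* (b :* d)) refl
                      (u (quotient n x)) (v (remainder {m} n x)) (u (quotient n y)) (v (remainder {m} n y)))
           (outer (λ x → u (quotient n x) * v (remainder {m} n x)))
  Gram-⊗ (outer u) zero         = ≈-resp (λ x y → sym (zeroʳ _)) zero
  Gram-⊗ (outer u) (b +ᴳ c)     = ≈-resp (λ x y → sym (distribˡ _ _ _)) (Gram-⊗ (outer u) b +ᴳ Gram-⊗ (outer u) c)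
  Gram-⊗ (outer u) (scale 0≤c b) =
    ≈-resp (λ x y → solve 3 (λ c a b → c :* (a :* b) := a :* (c :* b)) refl _ _ _) (scale 0≤c (Gram-⊗ (outer u) b))
  Gram-⊗ (outer u) (≈-resp eq b) = ≈-resp (λ x y → *-congˡ (eq _ _)) (Gram-⊗ (outer u) b)
  Gram-⊗ zero b                 = ≈-resp (λ x y → sym (zeroˡ _)) zero
  Gram-⊗ (a +ᴳ c) b             = ≈-resp (λ x y → sym (distribʳ _ _ _)) (Gram-⊗ a b +ᴳ Gram-⊗ c b)
  Gram-⊗ (scale 0≤c a) b        = ≈-resp (λ x y → sym (*-assoc _ _ _)) (scale 0≤c (Gram-⊗ a b))
  Gram-⊗ (≈-resp eq a) b        = ≈-resp (λ x y → *-congʳ (eq _ _)) (Gram-⊗ a b)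

  -- For the two sums below, which run over ordered pairs and so count every unordered pair twice.
  Gram-½ : ∀ {n} {A B : Matrix n n} → (∀ i j → A i j ≈ 2# * B i j) → Gram A → Gram B
  Gram-½ {A = A} {B} A≈2B a = ≈-resp
    (λ i j → trans (*-congˡ (A≈2B i j)) (trans (sym (*-assoc _ _ _)) (trans (*-congʳ ½*2≈1) (*-identityˡ _))))
    (scale ½-nonneg a)

  RowSum : ∀ {n} → Matrix n n → Carrier → Set
  RowSum {n} W b = ∀ i → ∑[ j < n ] W i j ≈ b

  -- This is the Laplacian of the graph with edge weights W: half the sum over k and l of W k l
  -- times the outer square of e k - e l, where e k is a unit vector.
  Laplacian-Gram : ∀ {n} {W : Matrix n n} {b} → Symmetric W → Nonnegative W → RowSum W b →
                   Gram (λ i j → b * I n i j - W i j)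
  Laplacian-Gram {n} {W} {b} W-sym 0≤W ∑W≈b = Gram-½ entry (Gram-∑ λ k → Gram-∑ λ l → scale (0≤W k l) (outer (λ i → I n k i - I n l i)))
    where
    δ : Fin n → Fin n → Carrier
    δ = I n
    open SetoidReasoning setoid
    pick : ∀ i (f : Vector Carrier n) → ∑[ k < n ] (δ k i * f k) ≈ f i
    pick = ∑-𝟙
    diagonal : ∀ i j → ∑[ k < n ] ∑[ l < n ] (W k l * (δ k i * δ k j)) ≈ b * δ i j
    diagonal i j = begin
      ∑[ k < n ] ∑[ l < n ] (W k l * (δ k i * δ k j)) ≈⟨ (∑-cong λ k → trans (∑-*ʳ (W k) _) (*-congʳ (∑W≈b k))) ⟩
      ∑[ k < n ] (b * (δ k i * δ k j))                ≈⟨ ∑-*ˡ b (λ k → δ k i * δ k j) ⟩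
      b * ∑[ k < n ] (δ k i * δ k j)                  ≈⟨ *-congˡ (pick i (λ k → δ k j)) ⟩
      b * δ i j                                       ∎
    offDiagonal : ∀ i j → ∑[ k < n ] ∑[ l < n ] (W k l * (δ k i * δ l j)) ≈ W i j
    offDiagonal i j = begin
      ∑[ k < n ] ∑[ l < n ] (W k l * (δ k i * δ l j))
        ≈⟨ (∑-cong λ k → trans (∑-cong λ l → solve 3 (λ w a b → w :* (a :* b) := a :* (b :* w)) refl (W k l) (δ k i) (δ l j)) (∑-*ˡ (δ k i) (λ l → δ l j * W k l))) ⟩
      ∑[ k < n ] (δ k i * ∑[ l < n ] (δ l j * W k l))  ≈⟨ pick i (λ k → ∑[ l < n ] (δ l j * W k l)) ⟩
      ∑[ l < n ] (δ l j * W i l)                       ≈⟨ pick j (W i) ⟩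
      W i j                                            ∎
    diagonal′ : ∀ i j → ∑[ k < n ] ∑[ l < n ] (W k l * (δ l i * δ l j)) ≈ b * δ i j
    diagonal′ i j = trans (∑-comm (λ k l → W k l * (δ l i * δ l j))) (trans (∑-cong λ l → ∑-cong λ k → *-congʳ (W-sym k l)) (diagonal i j))
    offDiagonal′ : ∀ i j → ∑[ k < n ] ∑[ l < n ] (W k l * (δ l i * δ k j)) ≈ W i j
    offDiagonal′ i j = trans (∑-comm (λ k l → W k l * (δ l i * δ k j))) (trans (∑-cong λ l → ∑-cong λ k → *-congʳ (W-sym k l)) (offDiagonal i j))
    entry : ∀ i j → ∑[ k < n ] ∑[ l < n ] (W k l * ((δ k i - δ l i) * (δ k j - δ l j))) ≈ 2# * (b * δ i j - W i j)
    entry i j = begin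
      ∑[ k < n ] ∑[ l < n ] (W k l * ((δ k i - δ l i) * (δ k j - δ l j)))
        ≈⟨ (∑-cong λ k → ∑-cong λ l → solve 5 (λ w a c d e → w :* ((a :- c) :* (d :- e)) :=
              (w :* (a :* d) :+ w :* (c :* e)) :- (w :* (a :* e) :+ w :* (c :* d))) refl
              (W k l) (δ k i) (δ l i) (δ k j) (δ l j)) ⟩
      ∑[ k < n ] ∑[ l < n ] ((W k l * (δ k i * δ k j) + W k l * (δ l i * δ l j))
                           - (W k l * (δ k i * δ l j) + W k l * (δ l i * δ k j)))
        ≈⟨ ∑∑-expand (λ k l → W k l * (δ k i * δ k j)) (λ k l → W k l * (δ l i * δ l j))
                     (λ k l → W k l * (δ k i * δ l j)) (λ k l → W k l * (δ l i * δ k j)) ⟩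
      (∑[ k < n ] ∑[ l < n ] (W k l * (δ k i * δ k j)) + ∑[ k < n ] ∑[ l < n ] (W k l * (δ l i * δ l j)))
        - (∑[ k < n ] ∑[ l < n ] (W k l * (δ k i * δ l j)) + ∑[ k < n ] ∑[ l < n ] (W k l * (δ l i * δ k j)))
        ≈⟨ +-cong (+-cong (diagonal i j) (diagonal′ i j)) (-‿cong (+-cong (offDiagonal i j) (offDiagonal′ i j))) ⟩
      (b * δ i j + b * δ i j) - (W i j + W i j)
        ≈⟨ solve 2 (λ x y → (x :+ x) :- (y :+ y) := (:1 :+ :1) :* (x :- y)) refl (b * δ i j) (W i j) ⟩
      2# * (b * δ i j - W i j) ∎

  -- Lagrange's identity: the matrix is half the sum, over ordered pairs of samples x and y, of the
  -- outer squares of f x - f y. Both patterns obtain `spread` from it.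
  covariance-Gram : ∀ {k n} (f : Fin k → Vector Carrier n) →
    Gram (λ p q → fromℕ k * ∑[ x < k ] (f x p * f x q) - (∑[ x < k ] f x p) * (∑[ x < k ] f x q))
  covariance-Gram {k} f = Gram-½ entry (Gram-∑ λ x → Gram-∑ λ y → outer (λ p → f x p - f y p))
    where
    open SetoidReasoning setoid
    entry : ∀ p q → ∑[ x < k ] ∑[ y < k ] ((f x p - f y p) * (f x q - f y q)) ≈
      2# * (fromℕ k * ∑[ x < k ] (f x p * f x q) - (∑[ x < k ] f x p) * (∑[ x < k ] f x q))
    entry p q = begin
      ∑[ x < k ] ∑[ y < k ] ((f x p - f y p) * (f x q - f y q))
        ≈⟨ (∑-cong λ x → ∑-cong λ y → solve 4 (λ a b c d → (a :- b) :* (c :- d) :=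
             (a :* c :+ b :* d) :- (a :* d :+ c :* b)) refl (f x p) (f y p) (f x q) (f y q)) ⟩
      ∑[ x < k ] ∑[ y < k ] ((f x p * f x q + f y p * f y q) - (f x p * f y q + f x q * f y p))
        ≈⟨ ∑∑-expand (λ x y → f x p * f x q) (λ x y → f y p * f y q) (λ x y → f x p * f y q) (λ x y → f x q * f y p) ⟩
      (∑[ x < k ] ∑[ y < k ] (f x p * f x q) + ∑[ x < k ] ∑[ y < k ] (f y p * f y q))
        - (∑[ x < k ] ∑[ y < k ] (f x p * f y q) + ∑[ x < k ] ∑[ y < k ] (f x q * f y p))
        ≈⟨ +-cong (+-cong (trans (∑-cong λ x → ∑-const k (f x p * f x q)) (∑-*ˡ (fromℕ k) (λ x → f x p * f x q)))
                          (∑-const k (∑[ y < k ] (f y p * f y q))))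
                  (-‿cong (+-cong (∑∑-* (λ x → f x p) (λ y → f y q)) (∑∑-* (λ x → f x q) (λ y → f y p)))) ⟩
      (fromℕ k * c + fromℕ k * c) - (a * b + b * a)
        ≈⟨ solve 4 (λ k c a b → (k :* c :+ k :* c) :- (a :* b :+ b :* a) := (:1 :+ :1) :* (k :* c :- a :* b)) refl (fromℕ k) c a b ⟩
      2# * (fromℕ k * c - a * b) ∎
      where
      a = ∑[ x < k ] f x p
      b = ∑[ x < k ] f x q
      c = ∑[ x < k ] (f x p * f x q)

  -- A feasible solution from two patterns

  trace-I : ∀ {n} (A : Matrix n n) → trace (I n *ᴹ A) ≈ trace A
  trace-I {n} A = trans (trace-Diag (λ _ → 1#) A) (∑-cong λ i → *-identityˡ (A i i))

  trace-*I : ∀ {n} (A : Matrix n n) → trace (A *ᴹ I n) ≈ trace A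
  trace-*I {n} A = ∑-cong λ i → trans (∑-cong λ k → *-comm (A i k) (I n k i)) (∑-𝟙 i (A i))

  trace-E : ∀ {n} (j : Fin n) (A : Matrix n n) → trace (E j *ᴹ A) ≈ A j j
  trace-E j A = trans (trace-Diag (λ i → 𝟙 (i ≟ j)) A) (∑-𝟙 j (λ i → A i i))

  I-diagonal : ∀ {n} (i : Fin n) → I n i i ≈ 1#
  I-diagonal i = reflexive (𝟙-yes (i ≟ i) ≡.refl)

  I-symmetric : ∀ {n} → Symmetric (I n)
  I-symmetric i j = reflexive (≟-sym i j)

  I-rowSum : ∀ {n} → RowSum (I n) 1#
  I-rowSum {n} i = trans (∑-cong λ j → I-symmetric i j) (∑-𝟙≈1 i)

  trace-J-I : ∀ n → trace ((J n -ᴹ I n) *ᴹ I n) ≈ 0#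
  trace-J-I n = trans (trace-*I (J n -ᴹ I n)) (∑-zero {n} λ i → trans (+-congˡ (-‿cong (I-diagonal i))) (-‿inverseʳ 1#))

  -- The same conditions are asked of the vertex side and of the position side, so the two families
  -- of constraints on `Y` have one proof each way. `spread` says that W stays positive semidefinite
  -- after its mean entry b / n is removed.
  record IsPattern {n : ℕ} (b : Carrier) (W : Matrix n n) : Set where
    field
      symmetric   : Symmetric W
      nonnegative : Nonnegative W
      ≤1          : ∀ i j → W i j ≤ 1#
      diagonal    : ∀ i → W i i ≈ 1#
      rowSum      : RowSum W b
      spread      : Gram (λ i j → fromℕ n * W i j - b)

    trace-I[W-I] : trace (I n *ᴹ (W -ᴹ I n)) ≈ 0#
    trace-I[W-I] = trans (trace-I (W -ᴹ I n)) (∑-zero λ i →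
      trans (+-cong (diagonal i) (-‿cong (I-diagonal i))) (-‿inverseʳ 1#))

    trace-I[J-W] : trace (I n *ᴹ (J n -ᴹ W)) ≈ 0#
    trace-I[J-W] = trans (trace-I (J n -ᴹ W)) (∑-zero λ i →
      trans (+-congˡ (-‿cong (diagonal i))) (-‿inverseʳ 1#))

    trace-J[W-I] : trace (J n *ᴹ (W -ᴹ I n)) ≈ fromℕ n * (b - 1#)
    trace-J[W-I] = trans (∑-cong λ i → trans
      (∑-cong λ k → trans (*-identityˡ _) (+-cong (symmetric k i) (-‿cong (I-symmetric k i))))
      (trans (∑-distrib-- (W i) (I n i)) (+-cong (rowSum i) (-‿cong (I-rowSum i)))))
      (∑-const n (b - 1#))

    ∑∑[1-W] : ∑[ i < n ] ∑[ k < n ] (1# - W i k) ≈ fromℕ n * (fromℕ n - b)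
    ∑∑[1-W] = trans (∑-cong λ i → trans (∑-distrib-- (λ _ → 1#) (W i))
      (+-cong (trans (∑-const n 1#) (*-identityʳ _)) (-‿cong (rowSum i))))
      (∑-const n (fromℕ n - b))

    trace-J[J-W] : trace (J n *ᴹ (J n -ᴹ W)) ≈ fromℕ n * (fromℕ n - b)
    trace-J[J-W] = trans (∑-cong λ i → ∑-cong λ k → trans (*-identityˡ _) (+-congˡ (-‿cong (symmetric k i)))) ∑∑[1-W]

    0≤W-I : ∀ i j → 0# ≤ W i j - I n i j
    0≤W-I i j with i ≟ j
    ... | yes ≡.refl = 0≤y-x (≤.reflexive (sym (diagonal i)))
    ... | no _       = 0≤y-x (nonnegative i j)

    0≤1-W : ∀ i j → 0# ≤ 1# - W i j
    0≤1-W i j = 0≤y-x (≤1 i j)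

    laplacian : Gram (λ i j → b * I n i j - W i j)
    laplacian = Laplacian-Gram symmetric nonnegative rowSum

  module Lift {n : ℕ} {b : Carrier} (1≤n : 1 ℕ.≤ n) (0<b-1 : 0# < b - 1#) (0<n-b : 0# < fromℕ n - b)
              {G M : Matrix n n} (G-pattern : IsPattern b G) (M-pattern : IsPattern b M) where

    private
      module G = IsPattern G-pattern
      module M = IsPattern M-pattern
      ν c d κ : Carrier
      ν = fromℕ n
      c = b - 1#
      d = ν - b
      κ = (ν * (c * d)) ⁻¹

      0<ν : 0# < ν
      0<ν = fromℕ-pos 1≤n

      0<νcd : 0# < ν * (c * d)
      0<νcd = *-pos 0<ν (*-pos 0<b-1 0<n-b)

      0<b : 0# < b
      0<b = <-≤-trans 0<b-1 (≤-by 0≤1 (solve 1 (λ b → b := (b :- :1) :+ :1) refl b))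

      0≤c : 0# ≤ c
      0≤c = <⇒≤ 0<b-1

      0≤d : 0# ≤ d
      0≤d = <⇒≤ 0<n-b

      0≤κ : 0# ≤ κ
      0≤κ = ⁻¹-nonneg 0<νcd

      κνcd≈1 : κ * (ν * (c * d)) ≈ 1#
      κνcd≈1 = ⁻¹-inverseˡ 0<νcd

    -- The coefficients 1 , 1 / (b - 1) and 1 / (n - b) are brought over the common denominator in
    -- `κ`, so that a single inverse occurs and all other arithmetic is polynomial.
    Y : Matrix (n ℕ.* n) (n ℕ.* n)
    Y = κ *ˢ ((c * d) *ˢ (I n ⊗ I n) +ᴹ (d *ˢ ((G -ᴹ I n) ⊗ (M -ᴹ I n)) +ᴹ c *ˢ ((J n -ᴹ G) ⊗ (J n -ᴹ M))))

    trace-Y : ∀ A B → trace ((A ⊗ B) *ᴹ Y) ≈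
      κ * (c * d * (trace (A *ᴹ I n) * trace (B *ᴹ I n))
        + (d * (trace (A *ᴹ (G -ᴹ I n)) * trace (B *ᴹ (M -ᴹ I n)))
        +  c * (trace (A *ᴹ (J n -ᴹ G)) * trace (B *ᴹ (J n -ᴹ M)))))
    trace-Y A B = trans (trace-*ˢʳ κ (A ⊗ B) _) (*-congˡ
      (trans (trace-+ʳ (A ⊗ B) _ _) (+-cong
        (trans (trace-*ˢʳ (c * d) (A ⊗ B) _) (*-congˡ (trace-⊗ A (I n) B (I n))))
        (trans (trace-+ʳ (A ⊗ B) _ _) (+-cong
          (trans (trace-*ˢʳ d (A ⊗ B) _) (*-congˡ (trace-⊗ A _ B _)))
          (trans (trace-*ˢʳ c (A ⊗ B) _) (*-congˡ (trace-⊗ A _ B _))))))))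

    -- The last two products are rewritten as wholes, so that knowing one factor to vanish is
    -- enough.
    trace-Y-cong : ∀ A B {a₁ a₂ a₃ b₁ b₂ b₃} →
      trace (A *ᴹ I n) ≈ a₁ → trace (B *ᴹ I n) ≈ b₁ →
      trace (A *ᴹ (G -ᴹ I n)) * trace (B *ᴹ (M -ᴹ I n)) ≈ a₂ * b₂ →
      trace (A *ᴹ (J n -ᴹ G)) * trace (B *ᴹ (J n -ᴹ M)) ≈ a₃ * b₃ →
      trace ((A ⊗ B) *ᴹ Y) ≈ κ * (c * d * (a₁ * b₁) + (d * (a₂ * b₂) + c * (a₃ * b₃)))
    trace-Y-cong A B a₁ b₁ ab₂ ab₃ = trans (trace-Y A B)
      (*-congˡ (+-cong (*-congˡ (*-cong a₁ b₁)) (+-cong (*-congˡ ab₂) (*-congˡ ab₃))))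

    Y-diagonal : ∀ x → Y x x ≈ κ * (c * d)
    Y-diagonal x = begin
      Y x x ≈⟨ *-congˡ (+-cong (*-congˡ (*-cong (I-diagonal i) (I-diagonal p)))
                (+-cong (*-congˡ (*-congʳ (+-cong (G.diagonal i) (-‿cong (I-diagonal i)))))
                        (*-congˡ (*-congʳ (+-congˡ (-‿cong (G.diagonal i))))))) ⟩
      κ * (c * d * (1# * 1#) + (d * ((1# - 1#) * m) + c * ((1# - 1#) * m′)))
        ≈⟨ solve 5 (λ κ c d m m′ → κ :* (c :* d :* (:1 :* :1) :+ (d :* ((:1 :- :1) :* m) :+ c :* ((:1 :- :1) :* m′)))
                      := κ :* (c :* d)) refl κ c d m m′ ⟩
      κ * (c * d) ∎
      where
      open SetoidReasoning setoid
      i = quotient n x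
      p = remainder {n} n x
      m = (M -ᴹ I n) p p
      m′ = (J n -ᴹ M) p p

    Y-symmetric : Symmetric Y
    Y-symmetric x y = *-congˡ (+-cong (*-congˡ (*-cong (I-symmetric i j) (I-symmetric p q)))
      (+-cong (*-congˡ (*-cong (+-cong (G.symmetric i j) (-‿cong (I-symmetric i j))) (+-cong (M.symmetric p q) (-‿cong (I-symmetric p q)))))
              (*-congˡ (*-cong (+-congˡ (-‿cong (G.symmetric i j))) (+-congˡ (-‿cong (M.symmetric p q)))))))
      where
      i = quotient n x
      p = remainder {n} n x
      j = quotient n y
      q = remainder {n} n y

    Y-nonnegative : Nonnegative Y
    Y-nonnegative x y = *-nonneg 0≤κ (+-nonneg
      (*-nonneg (*-nonneg 0≤c 0≤d) (*-nonneg (𝟙-nonneg (quotient n x ≟ quotient n y)) (𝟙-nonneg (remainder {n} n x ≟ remainder {n} n y))))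
      (+-nonneg (*-nonneg 0≤d (*-nonneg (G.0≤W-I _ _) (M.0≤W-I _ _)))
                (*-nonneg 0≤c (*-nonneg (G.0≤1-W _ _) (M.0≤1-W _ _)))))

    private
      spectral : Matrix (n ℕ.* n) (n ℕ.* n)
      spectral x y =
          (b * (c * d)) * (J n ⊗ J n) x y
        + c * ((λ i j → ν * G i j - b) ⊗ (λ i j → ν * M i j - b)) x y
        + (ν * d) * ((λ i j → b * I n i j - G i j) ⊗ (λ i j → b * I n i j - M i j)) x y

      spectral-Gram : Gram spectral
      spectral-Gram =
           scale (*-nonneg (<⇒≤ 0<b) (*-nonneg 0≤c 0≤d)) (Gram-⊗ J-Gram J-Gram)
        +ᴳ scale 0≤c (Gram-⊗ G.spread M.spread)
        +ᴳ scale (*-nonneg (<⇒≤ 0<ν) 0≤d) (Gram-⊗ G.laplacian M.laplacian)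
        where
        J-Gram : Gram (J n)
        J-Gram = ≈-resp (λ i j → *-identityˡ 1#) (outer (λ _ → 1#))

    -- Y is diagonalised over the commuting projections J / n, G / b − J / n and
    -- I − G / b; the coefficients there are J, ν M − b J and b I − M up to scale.
    Y-Gram : Gram Y
    Y-Gram = ≈-resp entry (scale (*-nonneg 0≤κ (⁻¹-nonneg 0<νb)) spectral-Gram)
      where
      0<νb : 0# < ν * b
      0<νb = *-pos 0<ν 0<b
      -- One entry of the expansion, with e and f for the entries of the identity matrices. It holds
      -- as a polynomial identity, with no relation among the six quantities.
      identity : ∀ ν b e g f m →
        (b * ((b - 1#) * (ν - b))) * (1# * 1#) + (b - 1#) * ((ν * g - b) * (ν * m - b)) + (ν * (ν - b)) * ((b * e - g) * (b * f - m))
        ≈ ν * b * ((b - 1#) * (ν - b) * (e * f) + ((ν - b) * ((g - e) * (m - f)) + (b - 1#) * ((1# - g) * (1# - m))))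
      identity = solve 6 (λ ν b e g f m →
        (b :* ((b :- :1) :* (ν :- b))) :* (:1 :* :1) :+ (b :- :1) :* ((ν :* g :- b) :* (ν :* m :- b)) :+ (ν :* (ν :- b)) :* ((b :* e :- g) :* (b :* f :- m))
        := ν :* b :* ((b :- :1) :* (ν :- b) :* (e :* f) :+ ((ν :- b) :* ((g :- e) :* (m :- f)) :+ (b :- :1) :* ((:1 :- g) :* (:1 :- m))))) refl
      entry : ∀ x y → (κ * (ν * b) ⁻¹) * spectral x y ≈ Y x y
      entry x y = begin
        (κ * (ν * b) ⁻¹) * spectral x y    ≈⟨ *-congˡ (identity ν b (I n i j) (G i j) (I n p q) (M p q)) ⟩
        (κ * (ν * b) ⁻¹) * ((ν * b) * Y′)  ≈⟨ solve 4 (λ κ u w y → (κ :* u) :* (w :* y) := (u :* w) :* (κ :* y)) refl κ ((ν * b) ⁻¹) (ν * b) Y′ ⟩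
        ((ν * b) ⁻¹ * (ν * b)) * (κ * Y′)  ≈⟨ *-congʳ (⁻¹-inverseˡ 0<νb) ⟩
        1# * (κ * Y′)                      ≈⟨ *-identityˡ _ ⟩
        Y x y                              ∎
        where
        open SetoidReasoning setoid
        i = quotient n x
        p = remainder {n} n x
        j = quotient n y
        q = remainder {n} n y
        Y′ = c * d * (I n i j * I n p q) + (d * ((G i j - I n i j) * (M p q - I n p q)) + c * ((1# - G i j) * (1# - M p q)))

    private
      κcdν≈1 : ∀ y z → κ * (c * d * (ν * 1#) + (d * (0# * y) + c * (0# * z))) ≈ 1#
      κcdν≈1 y z = trans (solve 6 (λ κ c d ν y z → κ :* (c :* d :* (ν :* :1) :+ (d :* (:0 :* y) :+ c :* (:0 :* z)))
        := κ :* (ν :* (c :* d))) refl κ c d ν y z) κνcd≈1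

      trace-Iⁿ : trace (I n *ᴹ I n) ≈ ν
      trace-Iⁿ = trans (trace-I (I n)) (trans (∑-cong {n} I-diagonal) (trans (∑-const n 1#) (*-identityʳ ν)))

      trace-EI : ∀ (j : Fin n) → trace (E j *ᴹ I n) ≈ 1#
      trace-EI j = trans (trace-E j (I n)) (I-diagonal j)

      trace-JI : trace (J n *ᴹ I n) ≈ ν
      trace-JI = trans (trace-*I (J n)) (trans (∑-const n 1#) (*-identityʳ ν))

    Y-I⊗E : ∀ (j : Fin n) → trace ((I n ⊗ E j) *ᴹ Y) ≈ 1#
    Y-I⊗E j = trans (trace-Y-cong (I n) (E j) trace-Iⁿ (trace-EI j) (*-congʳ G.trace-I[W-I]) (*-congʳ G.trace-I[J-W]))
      (κcdν≈1 _ _)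

    Y-E⊗I : ∀ (j : Fin n) → trace ((E j ⊗ I n) *ᴹ Y) ≈ 1#
    Y-E⊗I j = trans (trace-Y-cong (E j) (I n) (trace-EI j) trace-Iⁿ
        (trans (*-congˡ M.trace-I[W-I]) (*-comm _ _)) (trans (*-congˡ M.trace-I[J-W]) (*-comm _ _)))
      (trans (*-congˡ (+-congʳ (*-congˡ (*-comm 1# ν)))) (κcdν≈1 _ _))

    -- Against a factor I both group terms vanish, because the patterns have unit diagonals; the
    -- term I ⊗ I vanishes against the other factor J - I.
    Y-gangster : trace ((I n ⊗ (J n -ᴹ I n) +ᴹ (J n -ᴹ I n) ⊗ I n) *ᴹ Y) ≈ 0#
    Y-gangster = trans (trace-+ˡ (I n ⊗ (J n -ᴹ I n)) ((J n -ᴹ I n) ⊗ I n) Y) (trans (+-cong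
      (trans (trace-Y-cong (I n) (J n -ᴹ I n) trace-Iⁿ (trace-J-I n) (*-congʳ G.trace-I[W-I]) (*-congʳ G.trace-I[J-W]))
             (vanish ν 0# _ _ (zeroʳ ν)))
      (trans (trace-Y-cong (J n -ᴹ I n) (I n) (trace-J-I n) trace-Iⁿ
               (trans (*-congˡ M.trace-I[W-I]) (*-comm _ _)) (trans (*-congˡ M.trace-I[J-W]) (*-comm _ _)))
             (vanish 0# ν _ _ (zeroˡ ν))))
      (+-identityˡ 0#))
      where
      vanish : ∀ u v y z → u * v ≈ 0# → κ * (c * d * (u * v) + (d * (0# * y) + c * (0# * z))) ≈ 0#
      vanish u v y z uv≈0 = trans (*-congˡ (+-congʳ (*-congˡ uv≈0)))
        (solve 5 (λ κ c d y z → κ :* (c :* d :* :0 :+ (d :* (:0 :* y) :+ c :* (:0 :* z))) := :0) refl κ c d y z)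

    Y-J⊗J : trace ((J n ⊗ J n) *ᴹ Y) ≈ fromℕ (n ℕ.* n)
    Y-J⊗J = begin
      trace ((J n ⊗ J n) *ᴹ Y)
        ≈⟨ trace-Y-cong (J n) (J n) trace-JI trace-JI (*-cong G.trace-J[W-I] M.trace-J[W-I]) (*-cong G.trace-J[J-W] M.trace-J[J-W]) ⟩
      κ * (c * d * (ν * ν) + (d * (ν * c * (ν * c)) + c * (ν * d * (ν * d))))
        -- The three terms add up to ν² c d (1 + c + d), and 1 + c + d = ν.
        ≈⟨ solve 3 (λ κ ν b → let c = b :- :1 ; d = ν :- b in
             κ :* (c :* d :* (ν :* ν) :+ (d :* (ν :* c :* (ν :* c)) :+ c :* (ν :* d :* (ν :* d))))
             := κ :* (ν :* (c :* d)) :* (ν :* ν)) refl κ ν b ⟩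
      κ * (ν * (c * d)) * (ν * ν)   ≈⟨ *-congʳ κνcd≈1 ⟩
      1# * (ν * ν)                  ≈⟨ *-identityˡ _ ⟩
      ν * ν                         ≈⟨ fromℕ-* n n ⟨
      fromℕ (n ℕ.* n)               ∎
      where open SetoidReasoning setoid

    module Program (r s : Fin (suc n)) (D : Matrix (suc n) (suc n)) where
      open SDP₂ r s D

      Y-feasible : Feasible Y
      Y-feasible = record
        { symmetric = Y-symmetric
        ; nonnegative = Y-nonnegative
        ; positiveSemidefinite = Gram⇒PSD Y-Gram
        ; trace-I⊗E = Y-I⊗E
        ; trace-E⊗I = Y-E⊗I
        ; trace-gangster = Y-gangster
        ; trace-J⊗J = Y-J⊗J
        }

      module _ {δ : Carrier}
               (G-idem : ∀ i j → G i j * G i j ≈ G i j)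
               (D≈1-G : ∀ i j → D (β i) (β j) ≈ 1# - G i j)
               (Dₛ≤1 : ∀ i → D s (β i) ≤ 1#)
               (degree≤2 : ∀ p → ∑[ q < n ] C₁ n (α p) (α q) ≤ 2#)
               (degreeᵣ≤2 : ∑[ p < n ] C₁ n (α p) r ≤ 2#)
               (C-nonneg : ∀ i j → 0# ≤ C₁ n i j)
               (C[1-M]≤Cδ : ∀ p q → C₁ n (α p) (α q) * (1# - M p q) ≤ C₁ n (α p) (α q) * δ)
               (0≤δ : 0# ≤ δ)
               where

        private
          D′ C C½ : Matrix n n
          D′ = submatrix D β β
          C = submatrix (C₁ n) α α
          C½ = ½ *ˢ C

          trace-D′I : trace (D′ *ᴹ I n) ≈ 0#
          trace-D′I = trans (trace-*I D′) (∑-zero λ i →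
            trans (D≈1-G i i) (trans (+-congˡ (-‿cong (G.diagonal i))) (-‿inverseʳ 1#)))

          trace-D′[G-I] : trace (D′ *ᴹ (G -ᴹ I n)) ≈ 0#
          trace-D′[G-I] = ∑-zero λ i → ∑-zero λ k → begin
            D′ i k * (G k i - I n k i)      ≈⟨ *-cong (D≈1-G i k) (+-cong (G.symmetric k i) (-‿cong (I-symmetric k i))) ⟩
            (1# - G i k) * (G i k - I n i k)
              ≈⟨ solve 2 (λ g e → (:1 :- g) :* (g :- e) := (g :- g :* g) :- (:1 :- g) :* e) refl (G i k) (I n i k) ⟩
            (G i k - G i k * G i k) - (1# - G i k) * I n i k
              ≈⟨ +-cong (trans (+-congˡ (-‿cong (G-idem i k))) (-‿inverseʳ _)) (-‿cong (off-diagonal i k)) ⟩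
            0# - 0#                         ≈⟨ -‿inverseʳ 0# ⟩
            0#                              ∎
            where
            open SetoidReasoning setoid
            off-diagonal : ∀ i k → (1# - G i k) * I n i k ≈ 0#
            off-diagonal i k with i ≟ k
            ... | yes ≡.refl = trans (*-identityʳ _) (trans (+-congˡ (-‿cong (G.diagonal i))) (-‿inverseʳ 1#))
            ... | no _       = zeroʳ _

          trace-D′[J-G] : trace (D′ *ᴹ (J n -ᴹ G)) ≈ ν * d
          trace-D′[J-G] = trans (∑-cong λ i → ∑-cong λ k → begin
            D′ i k * (1# - G k i)           ≈⟨ *-cong (D≈1-G i k) (+-congˡ (-‿cong (G.symmetric k i))) ⟩
            (1# - G i k) * (1# - G i k)
              ≈⟨ solve 1 (λ g → (:1 :- g) :* (:1 :- g) := :1 :- g :+ (g :* g :- g)) refl (G i k) ⟩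
            1# - G i k + (G i k * G i k - G i k)
              ≈⟨ +-congˡ (trans (+-congʳ (G-idem i k)) (-‿inverseʳ _)) ⟩
            1# - G i k + 0#                 ≈⟨ +-identityʳ _ ⟩
            1# - G i k                      ∎)
            G.∑∑[1-W]
            where open SetoidReasoning setoid

          -- The factor ½ undoes the counting of each edge from both ends: n rows of degree at most
          -- two then cost at most δ each.
          trace-C½[J-M] : trace (C½ *ᴹ (J n -ᴹ M)) ≤ ν * δ
          trace-C½[J-M] = begin
            ∑[ p < n ] ∑[ q < n ] (½ * C p q * (1# - M q p))
              ≈⟨ (∑-cong λ p → ∑-cong λ q → trans (*-congˡ (+-congˡ (-‿cong (M.symmetric q p)))) (*-assoc _ _ _)) ⟩
            ∑[ p < n ] ∑[ q < n ] (½ * (C p q * (1# - M p q)))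
              ≤⟨ (∑-mono-≤ λ p → ∑-mono-≤ λ q → *-monoʳ-≤ ½-nonneg (C[1-M]≤Cδ p q)) ⟩
            ∑[ p < n ] ∑[ q < n ] (½ * (C p q * δ))
              ≈⟨ (∑-cong λ p → trans (∑-*ˡ ½ (λ q → C p q * δ)) (*-congˡ (∑-*ʳ (C p) δ))) ⟩
            ∑[ p < n ] (½ * (∑[ q < n ] C p q * δ))
              ≤⟨ (∑-mono-≤ λ p → *-monoʳ-≤ ½-nonneg (≤.trans (≤.reflexive (*-comm _ δ)) (*-monoʳ-≤ 0≤δ (degree≤2 p)))) ⟩
            ∑[ p < n ] (½ * (δ * 2#))
              ≈⟨ ∑-const n _ ⟩
            ν * (½ * (δ * 2#))
              ≈⟨ *-congˡ (trans (solve 3 (λ h δ t → h :* (δ :* t) := (h :* t) :* δ) refl ½ δ 2#) (trans (*-congʳ ½*2≈1) (*-identityˡ δ))) ⟩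
            ν * δ ∎
            where open ≤-Reasoning

          -- Distances vanish on equal vertices and inside groups, so only the term with J - G pays.
          -- Its vertex trace ν d cancels the normalisation and leaves the cost of 1 - M along the
          -- positions.
          trace-kronecker : trace ((D′ ⊗ C½) *ᴹ Y) ≤ ν * δ
          trace-kronecker = begin
            trace ((D′ ⊗ C½) *ᴹ Y)
              ≈⟨ trace-Y-cong D′ C½ trace-D′I refl (*-congʳ trace-D′[G-I]) (*-congʳ trace-D′[J-G]) ⟩
            κ * (c * d * (0# * _) + (d * (0# * _) + c * (ν * d * t)))
              ≈⟨ solve 7 (λ κ c d ν t y z → κ :* (c :* d :* (:0 :* y) :+ (d :* (:0 :* z) :+ c :* (ν :* d :* t)))
                   := κ :* (ν :* (c :* d)) :* t) refl κ c d ν t _ _ ⟩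
            κ * (ν * (c * d)) * t
              ≈⟨ trans (*-congʳ κνcd≈1) (*-identityˡ t) ⟩
            t ≤⟨ trace-C½[J-M] ⟩
            ν * δ ∎
            where
            open ≤-Reasoning
            t = trace (C½ *ᴹ (J n -ᴹ M))

          -- The deleted position has at most two neighbours, each holding every vertex with weight
          -- 1 / n, and no distance from the deleted vertex exceeds one.
          trace-linear : trace (Diag c̄ *ᴹ Y) ≤ 2#
          trace-linear = begin
            trace (Diag c̄ *ᴹ Y)
              ≈⟨ trace-Diag c̄ Y ⟩
            ∑[ x < n ℕ.* n ] (c̄ x * Y x x)
              ≈⟨ (∑-cong λ x → *-congˡ (Y-diagonal x)) ⟩
            ∑[ x < n ℕ.* n ] (c̄ x * (κ * (c * d)))
              ≈⟨ ∑-*ʳ c̄ (κ * (c * d)) ⟩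
            sum c̄ * (κ * (c * d))
              -- The summand `0#` is the empty tail of the sum over `Fin 1` in the product of a
              -- column and a row.
              ≈⟨ *-congʳ (∑-remQuot n n (λ i p → C₁ n (α p) r * D s (β i) + 0#)) ⟩
            (∑[ i < n ] ∑[ p < n ] (C₁ n (α p) r * D s (β i) + 0#)) * (κ * (c * d))
              ≈⟨ *-comm _ _ ⟩
            κ * (c * d) * (∑[ i < n ] ∑[ p < n ] (C₁ n (α p) r * D s (β i) + 0#))
              ≤⟨ *-monoʳ-≤ 0≤κcd (∑-mono-≤ λ i → ≤.trans (∑-mono-≤ λ p → bound i p) degreeᵣ≤2) ⟩
            κ * (c * d) * (∑[ i < n ] 2#)
              ≈⟨ *-congˡ (∑-const n 2#) ⟩
            κ * (c * d) * (ν * 2#)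
              ≈⟨ solve 5 (λ κ c d ν t → κ :* (c :* d) :* (ν :* t) := κ :* (ν :* (c :* d)) :* t) refl κ c d ν 2# ⟩
            κ * (ν * (c * d)) * 2#
              ≈⟨ trans (*-congʳ κνcd≈1) (*-identityˡ 2#) ⟩
            2# ∎
            where
            open ≤-Reasoning
            0≤κcd : 0# ≤ κ * (c * d)
            0≤κcd = *-nonneg 0≤κ (*-nonneg 0≤c 0≤d)
            bound : ∀ i p → C₁ n (α p) r * D s (β i) + 0# ≤ C₁ n (α p) r
            bound i p = ≤.trans (≤.reflexive (+-identityʳ _)) (≤.trans (*-monoʳ-≤ (C-nonneg (α p) r) (Dₛ≤1 i))
              (≤.reflexive (*-identityʳ _)))

        objective-Y : objective Y ≤ 2# + ν * δ
        objective-Y = ≤.trans (≤.reflexive (trace-+ˡ (D′ ⊗ C½) (Diag c̄) Y))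
          (≤.trans (+-mono-≤ trace-kronecker trace-linear) (≤.reflexive (+-comm _ _)))

  -- Windows on a cycle

  module Inner {n : ℕ} where
    ⟪_,_⟫ : Vector Carrier n → Vector Carrier n → Carrier
    ⟪ f , g ⟫ = ∑[ x < n ] (f x * g x)

    ⟪⟫-nonneg : ∀ {f g : Vector Carrier n} → (∀ x → 0# ≤ f x) → (∀ x → 0# ≤ g x) → 0# ≤ ⟪ f , g ⟫
    ⟪⟫-nonneg 0≤f 0≤g = ∑-nonneg λ x → *-nonneg (0≤f x) (0≤g x)

    ⟪⟫-comm : ∀ f g → ⟪ f , g ⟫ ≈ ⟪ g , f ⟫
    ⟪⟫-comm f g = ∑-cong λ x → *-comm (f x) (g x)

    ⟪⟫-cong : ∀ {f f′ g g′ : Vector Carrier n} → (∀ x → f x ≈ f′ x) → (∀ x → g x ≈ g′ x) → ⟪ f , g ⟫ ≈ ⟪ f′ , g′ ⟫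
    ⟪⟫-cong f≈f′ g≈g′ = ∑-cong λ x → *-cong (f≈f′ x) (g≈g′ x)

    ⟪∑,⟫ : ∀ {k} (f : Fin k → Vector Carrier n) g →
           ⟪ (λ x → ∑[ j < k ] f j x) , g ⟫ ≈ ∑[ j < k ] ⟪ f j , g ⟫
    ⟪∑,⟫ f g = trans (∑-cong λ x → sym (∑-*ʳ (λ j → f j x) (g x))) (∑-comm (λ x j → f j x * g x))

    ⟪,∑⟫ : ∀ {k} f (g : Fin k → Vector Carrier n) →
           ⟪ f , (λ x → ∑[ j < k ] g j x) ⟫ ≈ ∑[ j < k ] ⟪ f , g j ⟫
    ⟪,∑⟫ {k} f g = trans (⟪⟫-comm f (λ x → ∑[ j < k ] g j x)) (trans (⟪∑,⟫ g f) (∑-cong λ j → ⟪⟫-comm (g j) f))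

    square-of-difference : ∀ a b (f g : Vector Carrier n) →
      ⟪ (λ x → a * f x - b * g x) , (λ x → a * f x - b * g x) ⟫ ≈
      (a * a * ⟪ f , f ⟫ + b * b * ⟪ g , g ⟫) - (a * b * ⟪ f , g ⟫ + a * b * ⟪ f , g ⟫)
    square-of-difference a b f g = begin
      ⟪ (λ x → a * f x - b * g x) , (λ x → a * f x - b * g x) ⟫
        ≈⟨ (∑-cong λ x → solve 4 (λ a b f g → (a :* f :- b :* g) :* (a :* f :- b :* g) :=
             (a :* a :* (f :* f) :+ b :* b :* (g :* g)) :- (a :* b :* (f :* g) :+ a :* b :* (f :* g))) refl a b (f x) (g x)) ⟩
      ∑[ x < n ] ((a * a * (f x * f x) + b * b * (g x * g x)) - (a * b * (f x * g x) + a * b * (f x * g x)))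
        ≈⟨ trans (∑-distrib-- (λ x → a * a * (f x * f x) + b * b * (g x * g x)) (λ x → a * b * (f x * g x) + a * b * (f x * g x)))
             (+-cong (∑-distrib-+ (λ x → a * a * (f x * f x)) (λ x → b * b * (g x * g x)))
                     (-‿cong (∑-distrib-+ (λ x → a * b * (f x * g x)) (λ x → a * b * (f x * g x))))) ⟩
      (∑[ x < n ] (a * a * (f x * f x)) + ∑[ x < n ] (b * b * (g x * g x)))
        - (∑[ x < n ] (a * b * (f x * g x)) + ∑[ x < n ] (a * b * (f x * g x)))
        ≈⟨ +-cong (+-cong (∑-*ˡ (a * a) (λ x → f x * f x)) (∑-*ˡ (b * b) (λ x → g x * g x)))
                  (-‿cong (+-cong (∑-*ˡ (a * b) (λ x → f x * g x)) (∑-*ˡ (a * b) (λ x → f x * g x)))) ⟩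
      (a * a * ⟪ f , f ⟫ + b * b * ⟪ g , g ⟫) - (a * b * ⟪ f , g ⟫ + a * b * ⟪ f , g ⟫) ∎
      where open SetoidReasoning setoid

  open Inner

  ∑-shift : ∀ h (g : ℕ → Carrier) →
    g 0 + ∑[ j < h ] g (suc (toℕ j)) ≈ ∑[ j < h ] g (toℕ j) + g h
  ∑-shift zero    g = trans (+-identityʳ _) (sym (+-identityˡ _))
  ∑-shift (suc h) g = trans (+-congˡ (∑-shift h (g ∘ suc))) (sym (+-assoc _ _ _))

  -- With n = suc m, adding c m completes c to the multiple c n; this replaces the subtraction of c.
  %-cancelˡ-+ : ∀ n .{{_ : NonZero n}} c a b → (c ℕ.+ a) % n ≡ (c ℕ.+ b) % n → a % n ≡ b % n
  %-cancelˡ-+ n@(suc m) c a b eq = ≡.trans (≡.sym (unshift a)) (≡.trans shifted (unshift b))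
    where
    unshift : ∀ a → (c ℕ.* m ℕ.+ (c ℕ.+ a)) % n ≡ a % n
    unshift a = ≡.trans (≡.cong (_% n) rearranged) ([m+kn]%n≡m%n a c n)
      where
      rearranged : c ℕ.* m ℕ.+ (c ℕ.+ a) ≡ a ℕ.+ c ℕ.* n
      rearranged = ≡.trans (≡.sym (ℕ.+-assoc (c ℕ.* m) c a)) (≡.trans (ℕ.+-comm _ a)
        (≡.cong (a ℕ.+_) (≡.trans (ℕ.+-comm (c ℕ.* m) c) (≡.sym (ℕ.*-suc c m)))))
    shifted : (c ℕ.* m ℕ.+ (c ℕ.+ a)) % n ≡ (c ℕ.* m ℕ.+ (c ℕ.+ b)) % n
    shifted = ≡.trans (%-distribˡ-+ (c ℕ.* m) (c ℕ.+ a) n)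
      (≡.trans (≡.cong (λ r → ((c ℕ.* m) % n ℕ.+ r) % n) eq) (≡.sym (%-distribˡ-+ (c ℕ.* m) (c ℕ.+ b) n)))

  %-congˡ-+ : ∀ n .{{_ : NonZero n}} c a b → a % n ≡ b % n → (c ℕ.+ a) % n ≡ (c ℕ.+ b) % n
  %-congˡ-+ n c a b eq = ≡.trans (%-distribˡ-+ c a n)
    (≡.trans (≡.cong (λ r → (c % n ℕ.+ r) % n) eq) (≡.sym (%-distribˡ-+ c b n)))

  module _ {n : ℕ} .{{_ : NonZero n}} where

    toℕ-mod : ∀ a → toℕ (a mod n) ≡ a % n
    toℕ-mod a = toℕ-fromℕ< (m%n<n a n)

    %⇒mod : ∀ a b → a % n ≡ b % n → a mod n ≡ b mod n
    %⇒mod a b eq = toℕ-injective (≡.trans (toℕ-mod a) (≡.trans eq (≡.sym (toℕ-mod b))))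

    mod⇒% : ∀ a b → a mod n ≡ b mod n → a % n ≡ b % n
    mod⇒% a b eq = ≡.trans (≡.sym (toℕ-mod a)) (≡.trans (≡.cong toℕ eq) (toℕ-mod b))

    mod-toℕ : ∀ (x : Fin n) → toℕ x mod n ≡ x
    mod-toℕ x = toℕ-injective (≡.trans (toℕ-mod (toℕ x)) (m<n⇒m%n≡m (toℕ<n x)))

    -- Translates are indexed by natural numbers, so that a translation is a plain addition;
    -- `Periodic` states that only the residue modulo n matters.
    point : ℕ → Vector Carrier n
    point a x = 𝟙 (x ≟ a mod n)

    -- Convolution with an interval of h points. Applied to `point` it gives interval indicators as
    -- long as h ≤ n, and applied twice it gives hats.
    window : ℕ → (ℕ → Vector Carrier n) → ℕ → Vector Carrier n
    window h f a x = ∑[ j < h ] f (a ℕ.+ toℕ j) x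

    Periodic Positive ShiftInvariant : (ℕ → Vector Carrier n) → Set
    Periodic f       = ∀ a b → a % n ≡ b % n → ∀ x → f a x ≈ f b x
    Positive f       = ∀ a x → 0# ≤ f a x
    ShiftInvariant f = ∀ c a b → ⟪ f (c ℕ.+ a) , f (c ℕ.+ b) ⟫ ≈ ⟪ f a , f b ⟫

    Mass ColumnMass : (ℕ → Vector Carrier n) → Carrier → Set
    Mass f m       = ∀ a → ∑[ x < n ] f a x ≈ m
    ColumnMass f m = ∀ c x → ∑[ p < n ] f (toℕ p ℕ.+ c) x ≈ m

    point-periodic : Periodic point
    point-periodic a b eq x = reflexive (≡.cong (λ y → 𝟙 (x ≟ y)) (%⇒mod a b eq))

    point-positive : Positive point
    point-positive a x = 𝟙-nonneg (x ≟ a mod n)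

    ⟪point,⟫ : ∀ a (f : Vector Carrier n) → ⟪ point a , f ⟫ ≈ f (a mod n)
    ⟪point,⟫ a f = ∑-𝟙 (a mod n) f

    point-shiftInvariant : ShiftInvariant point
    point-shiftInvariant c a b = begin
      ⟪ point (c ℕ.+ a) , point (c ℕ.+ b) ⟫      ≈⟨ ⟪point,⟫ (c ℕ.+ a) (point (c ℕ.+ b)) ⟩
      𝟙 ((c ℕ.+ a) mod n ≟ (c ℕ.+ b) mod n)
        ≡⟨ 𝟙-cong ((c ℕ.+ a) mod n ≟ (c ℕ.+ b) mod n) (a mod n ≟ b mod n)
             (λ eq → %⇒mod a b (%-cancelˡ-+ n c a b (mod⇒% (c ℕ.+ a) (c ℕ.+ b) eq)))
             (λ eq → %⇒mod (c ℕ.+ a) (c ℕ.+ b) (%-congˡ-+ n c a b (mod⇒% a b eq))) ⟩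
      𝟙 (a mod n ≟ b mod n)                      ≈⟨ ⟪point,⟫ a (point b) ⟨
      ⟪ point a , point b ⟫                      ∎
      where open SetoidReasoning setoid

    point-mass : Mass point 1#
    point-mass a = ∑-𝟙≈1 (a mod n)

    point-columnMass : ColumnMass point 1#
    point-columnMass c x = trans (∑-cong λ p → reflexive (𝟙-cong (x ≟ (toℕ p ℕ.+ c) mod n) (p ≟ y) (to p) (from p))) (∑-𝟙≈1 y)
      where
      y : Fin n
      -- This is x - c modulo n, the only translate that hits x, written without subtraction.
      y = (toℕ x ℕ.+ c ℕ.* ℕ.pred n) mod n
      open ≡.≡-Reasoning
      c+c[n-1] : c ℕ.+ c ℕ.* ℕ.pred n ≡ c ℕ.* n
      c+c[n-1] = ≡.trans (≡.sym (ℕ.*-suc c (ℕ.pred n))) (≡.cong (c ℕ.*_) (ℕ.suc-pred n))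
      cycle : ∀ m → (c ℕ.+ (m ℕ.+ c ℕ.* ℕ.pred n)) % n ≡ m % n
      cycle m = begin
        (c ℕ.+ (m ℕ.+ c ℕ.* ℕ.pred n)) % n ≡⟨ ≡.cong (_% n) (≡.trans (≡.sym (ℕ.+-assoc c m _)) (≡.trans (≡.cong (ℕ._+ (c ℕ.* ℕ.pred n)) (ℕ.+-comm c m)) (ℕ.+-assoc m c _))) ⟩
        (m ℕ.+ (c ℕ.+ c ℕ.* ℕ.pred n)) % n ≡⟨ ≡.cong (λ k → (m ℕ.+ k) % n) c+c[n-1] ⟩
        (m ℕ.+ c ℕ.* n) % n                ≡⟨ [m+kn]%n≡m%n m c n ⟩
        m % n                              ∎
      x%n : toℕ x % n ≡ toℕ x
      x%n = m<n⇒m%n≡m (toℕ<n x)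
      from : ∀ p → p ≡ y → x ≡ (toℕ p ℕ.+ c) mod n
      from p ≡.refl = toℕ-injective (begin
        toℕ x                     ≡⟨ x%n ⟨
        toℕ x % n                 ≡⟨ cycle (toℕ x) ⟨
        (c ℕ.+ (toℕ x ℕ.+ c ℕ.* ℕ.pred n)) % n
          ≡⟨ %-congˡ-+ n c _ _ (≡.sym (≡.trans (≡.cong (λ z → toℕ z % n) (≡.refl {x = y})) (≡.trans (≡.cong (_% n) (toℕ-mod _)) (m%n%n≡m%n _ n)))) ⟩
        (c ℕ.+ toℕ y) % n         ≡⟨ ≡.cong (_% n) (ℕ.+-comm c (toℕ y)) ⟩
        (toℕ y ℕ.+ c) % n         ≡⟨ toℕ-mod _ ⟨
        toℕ ((toℕ y ℕ.+ c) mod n) ∎)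
      to : ∀ p → x ≡ (toℕ p ℕ.+ c) mod n → p ≡ y
      to p eq = ≡.trans (≡.sym (mod-toℕ p)) (%⇒mod (toℕ p) _ (%-cancelˡ-+ n c _ _ (begin
        (c ℕ.+ toℕ p) % n         ≡⟨ ≡.cong (_% n) (ℕ.+-comm c (toℕ p)) ⟩
        (toℕ p ℕ.+ c) % n         ≡⟨ toℕ-mod _ ⟨
        toℕ ((toℕ p ℕ.+ c) mod n) ≡⟨ ≡.cong toℕ eq ⟨
        toℕ x                     ≡⟨ x%n ⟨
        toℕ x % n                 ≡⟨ cycle (toℕ x) ⟨
        (c ℕ.+ (toℕ x ℕ.+ c ℕ.* ℕ.pred n)) % n ∎)))

    window-periodic : ∀ h {f} → Periodic f → Periodic (window h f)
    window-periodic h f-per a b eq x = ∑-cong {h} λ j → f-per (a ℕ.+ toℕ j) (b ℕ.+ toℕ j)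
      (≡.trans (≡.cong (_% n) (ℕ.+-comm a _)) (≡.trans (%-congˡ-+ n (toℕ j) a b eq) (≡.cong (_% n) (ℕ.+-comm (toℕ j) b)))) x

    window-positive : ∀ h {f} → Positive f → Positive (window h f)
    window-positive h f-pos a x = ∑-nonneg {h} λ j → f-pos (a ℕ.+ toℕ j) x

    ⟪window,window⟫ : ∀ h f g a b → ⟪ window h f a , window h g b ⟫ ≈
      ∑[ i < h ] ∑[ j < h ] ⟪ f (a ℕ.+ toℕ i) , g (b ℕ.+ toℕ j) ⟫
    ⟪window,window⟫ h f g a b = trans (⟪∑,⟫ {k = h} (λ i → f (a ℕ.+ toℕ i)) (window h g b))
      (∑-cong {h} λ i → ⟪,∑⟫ {k = h} (f (a ℕ.+ toℕ i)) (λ j → g (b ℕ.+ toℕ j)))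

    window-shiftInvariant : ∀ h {f} → ShiftInvariant f → ShiftInvariant (window h f)
    window-shiftInvariant h {f} f-inv c a b = begin
      ⟪ window h f (c ℕ.+ a) , window h f (c ℕ.+ b) ⟫ ≈⟨ ⟪window,window⟫ h f f (c ℕ.+ a) (c ℕ.+ b) ⟩
      ∑[ i < h ] ∑[ j < h ] ⟪ f (c ℕ.+ a ℕ.+ toℕ i) , f (c ℕ.+ b ℕ.+ toℕ j) ⟫
        ≈⟨ (∑-cong {h} λ i → ∑-cong {h} λ j → trans
             (reflexive (≡.cong₂ (λ k l → ⟪ f k , f l ⟫) (ℕ.+-assoc c a (toℕ i)) (ℕ.+-assoc c b (toℕ j))))
             (f-inv c (a ℕ.+ toℕ i) (b ℕ.+ toℕ j))) ⟩
      ∑[ i < h ] ∑[ j < h ] ⟪ f (a ℕ.+ toℕ i) , f (b ℕ.+ toℕ j) ⟫ ≈⟨ ⟪window,window⟫ h f f a b ⟨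
      ⟪ window h f a , window h f b ⟫ ∎
      where open SetoidReasoning setoid

    window-mass : ∀ h {f m} → Mass f m → Mass (window h f) (fromℕ h * m)
    window-mass h {f} {m} f-mass a = trans (∑-comm (λ x j → f (a ℕ.+ toℕ {h} j) x))
      (trans (∑-cong {h} λ j → f-mass (a ℕ.+ toℕ j)) (∑-const h m))

    window-columnMass : ∀ h {f m} → ColumnMass f m → ColumnMass (window h f) (fromℕ h * m)
    window-columnMass h {f} {m} f-mass c x = trans (∑-comm (λ (p : Fin n) (j : Fin h) → f (toℕ p ℕ.+ c ℕ.+ toℕ j) x))
      (trans (∑-cong {h} λ j → trans (∑-cong {n} λ p → reflexive (≡.cong (λ k → f k x) (ℕ.+-assoc (toℕ p) c (toℕ j)))) (f-mass (c ℕ.+ toℕ j) x)) (∑-const h m))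

    -- Consecutive windows share all but one term each; `∑-shift` splits the h + 1 terms from a to a
    -- + h at either end.
    window-step : ∀ h f a x → window h f (suc a) x - window h f a x ≈ f (a ℕ.+ h) x - f a x
    window-step h f a x = begin
      window h f (suc a) x - window h f a x
        ≈⟨ +-congʳ (∑-cong {h} λ j → reflexive (≡.cong (λ k → f k x) (≡.sym (ℕ.+-suc a (toℕ j))))) ⟩
      u′ - u
        ≈⟨ solve 3 (λ u u′ g → u′ :- u := (g :+ u′) :- (u :+ g)) refl u u′ (f (a ℕ.+ 0) x) ⟩
      (f (a ℕ.+ 0) x + u′) - (u + f (a ℕ.+ 0) x)
        ≈⟨ +-congʳ (∑-shift h (λ k → f (a ℕ.+ k) x)) ⟩
      (u + f (a ℕ.+ h) x) - (u + f (a ℕ.+ 0) x)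
        ≈⟨ solve 3 (λ u y z → (u :+ y) :- (u :+ z) := y :- z) refl u (f (a ℕ.+ h) x) (f (a ℕ.+ 0) x) ⟩
      f (a ℕ.+ h) x - f (a ℕ.+ 0) x
        ≈⟨ +-congˡ (-‿cong (reflexive (≡.cong (λ k → f k x) (ℕ.+-identityʳ a)))) ⟩
      f (a ℕ.+ h) x - f a x ∎
      where
      open SetoidReasoning setoid
      u u′ : Carrier
      u = ∑[ j < h ] f (a ℕ.+ toℕ j) x
      u′ = ∑[ j < h ] f (a ℕ.+ suc (toℕ j)) x

    -- As s ≤ n, the window does not wrap onto itself, and a is hit only by its term of index a.
    ⟪point,window⟫ : ∀ {a s} → a ℕ.< s → s ℕ.≤ n → ⟪ point a , window s point 0 ⟫ ≈ 1#
    ⟪point,window⟫ {a} {s} a<s s≤n = trans (⟪point,⟫ a (window s point 0))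
      (trans (∑-cong λ j → reflexive (𝟙-cong (a mod n ≟ toℕ j mod n) (j ≟ fromℕ< a<s) (to j) (from j))) (∑-𝟙≈1 (fromℕ< a<s)))
      where
      a%n : a % n ≡ a
      a%n = m<n⇒m%n≡m (ℕ.<-≤-trans a<s s≤n)
      to : ∀ j → a mod n ≡ toℕ j mod n → j ≡ fromℕ< a<s
      to j eq = toℕ-injective (≡.trans (≡.sym (m<n⇒m%n≡m (ℕ.<-≤-trans (toℕ<n j) s≤n)))
        (≡.trans (≡.sym (mod⇒% a (toℕ j) eq)) (≡.trans a%n (≡.sym (toℕ-fromℕ< a<s)))))
      from : ∀ j → j ≡ fromℕ< a<s → a mod n ≡ toℕ j mod n
      from j ≡.refl = ≡.cong (_mod n) (≡.sym (toℕ-fromℕ< a<s))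

    window-norm : ∀ {s} → s ℕ.≤ n → ⟪ window s point 0 , window s point 0 ⟫ ≈ fromℕ s
    window-norm {s} s≤n = trans (⟪∑,⟫ (λ i → point (toℕ {s} i)) (window s point 0))
      (trans (∑-cong λ i → ⟪point,window⟫ (toℕ<n i) s≤n) (trans (∑-const s 1#) (*-identityʳ _)))

  -- v a x counts the pairs j , k < h with a + j + k ≡ x (mod n): a discrete hat
  -- function of width 2 h.
  module Hat {n : ℕ} .{{_ : NonZero n}} (h : ℕ) (1≤h : 1 ℕ.≤ h) (2h<n : h ℕ.+ h ℕ.< n) where

    -- `S` is the mass of a hat and `Q` its squared norm, so every row of `F` sums to S². The matrix
    -- (A F + B J) / P is to have unit diagonal and row sums b; this asks for P = A Q + B and A S² +
    -- n B = b P, which the values below satisfy.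
    η b A B S Q P : Carrier

    T v : ℕ → Vector Carrier n
    T = window h point
    v = window h T

    F : ℕ → ℕ → Carrier
    F a c = ⟪ v a , v c ⟫

    η = fromℕ h
    b = η + η
    A = fromℕ n - b
    S = η * η
    Q = F 0 0
    B = b * Q - S * S
    P = A * Q + B

    v-periodic : Periodic v
    v-periodic = window-periodic h {T} (window-periodic h {point} point-periodic)

    v-shiftInvariant : ShiftInvariant v
    v-shiftInvariant = window-shiftInvariant h {T} (window-shiftInvariant h {point} point-shiftInvariant)

    T-shiftInvariant : ShiftInvariant T
    T-shiftInvariant = window-shiftInvariant h {point} point-shiftInvariant

    T-positive : Positive T
    T-positive = window-positive h {point} point-positive

    v-positive : Positive v
    v-positive = window-positive h {T} T-positive

    S≈ : fromℕ h * (fromℕ h * 1#) ≈ S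
    S≈ = *-congˡ (*-identityʳ η)

    v-mass : Mass v S
    v-mass a = trans (window-mass h {T} (window-mass h {point} point-mass) a) S≈

    v-columnMass : ∀ x → ∑[ p < n ] v (toℕ p) x ≈ S
    v-columnMass x = trans (∑-cong {n} λ p → reflexive (≡.cong (λ k → v k x) (≡.sym (ℕ.+-identityʳ (toℕ p)))))
      (trans (window-columnMass h {T} (window-columnMass h {point} point-columnMass) 0 x) S≈)

    F-diagonal : ∀ a → F a a ≈ Q
    F-diagonal a = trans (reflexive (≡.cong₂ F (≡.sym (ℕ.+-identityʳ a)) (≡.sym (ℕ.+-identityʳ a)))) (v-shiftInvariant a 0 0)

    F-comm : ∀ a c → F a c ≈ F c a
    F-comm a c = ⟪⟫-comm (v a) (v c)

    F-nonneg : ∀ a c → 0# ≤ F a c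
    F-nonneg a c = ⟪⟫-nonneg (v-positive a) (v-positive c)

    square≈ : ∀ a c → ⟪ (λ x → 1# * v a x - 1# * v c x) , (λ x → 1# * v a x - 1# * v c x) ⟫ ≈ 2# * (Q - F a c)
    square≈ a c = trans (square-of-difference 1# 1# (v a) (v c))
      (trans (+-congʳ (+-cong (*-congˡ (F-diagonal a)) (*-congˡ (F-diagonal c))))
        (solve 2 (λ q f → (:1 :* :1 :* q :+ :1 :* :1 :* q) :- (:1 :* :1 :* f :+ :1 :* :1 :* f)
          := (:1 :+ :1) :* (q :- f)) refl Q (F a c)))

    -- All translates have the norm of the first one, so twice the difference is the squared
    -- distance of two hats.
    F≤Q : ∀ a c → F a c ≤ Q
    F≤Q a c = 0≤y-x⇒x≤y (*-cancelˡ-≤ 0<2 (begin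
      2# * 0#          ≈⟨ zeroʳ 2# ⟩
      0#               ≤⟨ (∑-nonneg λ x → square-nonneg (1# * v a x - 1# * v c x)) ⟩
      ⟪ (λ x → 1# * v a x - 1# * v c x) , (λ x → 1# * v a x - 1# * v c x) ⟫ ≈⟨ square≈ a c ⟩
      2# * (Q - F a c) ∎))
      where open ≤-Reasoning

    private
      h≤n : h ℕ.≤ n
      h≤n = ℕ.≤-trans (ℕ.m≤m+n h h) (ℕ.<⇒≤ 2h<n)

    T-norm : ∀ a → ⟪ T a , T a ⟫ ≈ η
    T-norm a = trans (reflexive (≡.cong (λ k → ⟪ T k , T k ⟫) (≡.sym (ℕ.+-identityʳ a))))
      (trans (T-shiftInvariant a 0 0) (window-norm h≤n))

    -- Moving a hat by one step adds one window and removes another.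
    Q-F≤η : ∀ a → Q - F (suc a) a ≤ η
    Q-F≤η a = *-cancelˡ-≤ 0<2 (begin
      2# * (Q - F (suc a) a)
        ≈⟨ square≈ (suc a) a ⟨
      ⟪ (λ x → 1# * v (suc a) x - 1# * v a x) , (λ x → 1# * v (suc a) x - 1# * v a x) ⟫
        ≈⟨ ⟪⟫-cong step step ⟩
      ⟪ (λ x → 1# * T (a ℕ.+ h) x - 1# * T a x) , (λ x → 1# * T (a ℕ.+ h) x - 1# * T a x) ⟫
        ≈⟨ square-of-difference 1# 1# (T (a ℕ.+ h)) (T a) ⟩
      (1# * 1# * ⟪ T (a ℕ.+ h) , T (a ℕ.+ h) ⟫ + 1# * 1# * ⟪ T a , T a ⟫) - (1# * 1# * t + 1# * 1# * t)
        ≈⟨ +-congʳ (+-cong (*-congˡ (T-norm (a ℕ.+ h))) (*-congˡ (T-norm a))) ⟩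
      (1# * 1# * η + 1# * 1# * η) - (1# * 1# * t + 1# * 1# * t)
        ≤⟨ ≤-by (+-nonneg 0≤t 0≤t) (solve 2 (λ e t → (:1 :+ :1) :* e :=
             ((:1 :* :1 :* e :+ :1 :* :1 :* e) :- (:1 :* :1 :* t :+ :1 :* :1 :* t)) :+ (t :+ t)) refl η t) ⟩
      2# * η ∎)
      where
      open ≤-Reasoning
      t = ⟪ T (a ℕ.+ h) , T a ⟫
      0≤t : 0# ≤ t
      0≤t = ⟪⟫-nonneg (T-positive (a ℕ.+ h)) (T-positive a)
      step : ∀ x → 1# * v (suc a) x - 1# * v a x ≈ 1# * T (a ℕ.+ h) x - 1# * T a x
      step x = begin-equality
        1# * v (suc a) x - 1# * v a x       ≈⟨ +-cong (*-identityˡ _) (-‿cong (*-identityˡ _)) ⟩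
        v (suc a) x - v a x                 ≈⟨ window-step h T a x ⟩
        T (a ℕ.+ h) x - T a x               ≈⟨ +-cong (*-identityˡ _) (-‿cong (*-identityˡ _)) ⟨
        1# * T (a ℕ.+ h) x - 1# * T a x     ∎

    -- Cauchy–Schwarz against the indicator of the support of the hat.
    η³≤2Q : η * η * η ≤ 2# * Q
    η³≤2Q = *-cancelˡ-≤ 0<2 (0≤y-x⇒x≤y (begin
      -- The hat has mass η² on the 2 η points of `w`, hence mean η / 2 there; the vector is twice
      -- the deviation from that mean.
      0#  ≤⟨ (∑-nonneg λ x → square-nonneg (2# * v 0 x - η * w x)) ⟩
      ⟪ (λ x → 2# * v 0 x - η * w x) , (λ x → 2# * v 0 x - η * w x) ⟫
        ≈⟨ square-of-difference 2# η (v 0) w ⟩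
      (2# * 2# * Q + η * η * ⟪ w , w ⟫) - (2# * η * ⟪ v 0 , w ⟫ + 2# * η * ⟪ v 0 , w ⟫)
        ≈⟨ +-cong (+-congˡ (*-congˡ (trans (window-norm (ℕ.<⇒≤ 2h<n)) (fromℕ-+ h h))))
                  (-‿cong (+-cong (*-congˡ ⟪v,w⟫) (*-congˡ ⟪v,w⟫))) ⟩
      (2# * 2# * Q + η * η * (η + η)) - (2# * η * (η * η) + 2# * η * (η * η))
        ≈⟨ solve 2 (λ q e → let t = :1 :+ :1 in
             (t :* t :* q :+ e :* e :* (e :+ e)) :- (t :* e :* (e :* e) :+ t :* e :* (e :* e))
             := t :* (t :* q) :- t :* (e :* e :* e)) refl Q η ⟩
      2# * (2# * Q) - 2# * (η * η * η) ∎))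
      where
      open ≤-Reasoning
      w : Vector Carrier n
      w = window (h ℕ.+ h) point 0
      ⟪v,w⟫ : ⟪ v 0 , w ⟫ ≈ η * η
      ⟪v,w⟫ = begin-equality
        ⟪ v 0 , w ⟫
          ≈⟨ ⟪∑,⟫ {k = h} (λ j → T (toℕ j)) w ⟩
        ∑[ j < h ] ⟪ T (toℕ j) , w ⟫
          ≈⟨ (∑-cong {h} λ j → ⟪∑,⟫ {k = h} (λ k → point (toℕ j ℕ.+ toℕ k)) w) ⟩
        ∑[ j < h ] ∑[ k < h ] ⟪ point (toℕ j ℕ.+ toℕ k) , w ⟫
          ≈⟨ (∑-cong {h} λ j → ∑-cong {h} λ k → ⟪point,window⟫ (ℕ.+-mono-<-≤ (toℕ<n j) (ℕ.<⇒≤ (toℕ<n k))) (ℕ.<⇒≤ 2h<n)) ⟩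
        ∑[ j < h ] ∑[ k < h ] 1#
          ≈⟨ (∑-cong {h} λ j → trans (∑-const h 1#) (*-identityʳ η)) ⟩
        ∑[ j < h ] η
          ≈⟨ ∑-const h η ⟩
        η * η ∎

    private
      0<η : 0# < η
      0<η = fromℕ-pos 1≤h

    0<A : 0# < A
    0<A = <-≤-trans 0<1 (begin
      1#                                      ≈⟨ solve 1 (λ b → :1 := :1 :+ b :- b) refl b ⟩
      1# + b - b                              ≈⟨ +-congʳ (+-congˡ (sym (fromℕ-+ h h))) ⟩
      fromℕ (suc (h ℕ.+ h)) - b               ≤⟨ +-monoˡ-≤ (- b) (fromℕ-mono-≤ 2h<n) ⟩
      A                                       ∎)
      where open ≤-Reasoning

    0<Q : 0# < Q
    0<Q Q≤0 = *-pos (*-pos 0<η 0<η) 0<η (begin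
      η * η * η ≤⟨ η³≤2Q ⟩
      2# * Q    ≤⟨ *-monoʳ-≤ (<⇒≤ 0<2) Q≤0 ⟩
      2# * 0#   ≈⟨ zeroʳ 2# ⟩
      0#        ∎)
      where open ≤-Reasoning

    -- `B` is the weight of J in `M`. Its sign is what the row sum 2 h is good for: the squared mass
    -- is at most the support size 2 h times the squared norm.
    0≤B : 0# ≤ B
    0≤B = begin
      0#                       ≤⟨ *-nonneg (<⇒≤ 0<η) (0≤y-x η³≤2Q) ⟩
      η * (2# * Q - η * η * η) ≈⟨ solve 2 (λ e q → e :* ((:1 :+ :1) :* q :- e :* e :* e) := (e :+ e) :* q :- e :* e :* (e :* e)) refl η Q ⟩
      B                        ∎
      where open ≤-Reasoning

    0<P : 0# < P
    0<P = +-pos (*-pos 0<A 0<Q) 0≤B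

    private
      ρ : Carrier
      ρ = P ⁻¹

      0≤ρ : 0# ≤ ρ
      0≤ρ = ⁻¹-nonneg 0<P

      ρP≈1 : ρ * P ≈ 1#
      ρP≈1 = ⁻¹-inverseˡ 0<P

    -- The added multiple of J makes the row sums equal to the integer 2 h.
    M : Matrix n n
    M p q = ρ * (A * F (toℕ p) (toℕ q) + B)

    δ : Carrier
    δ = ρ * (A * η)

    0≤δ : 0# ≤ δ
    0≤δ = *-nonneg 0≤ρ (*-nonneg (<⇒≤ 0<A) (<⇒≤ 0<η))

    1-M≈ : ∀ p q → 1# - M p q ≈ ρ * (A * (Q - F (toℕ p) (toℕ q)))
    1-M≈ p q = trans (+-congʳ (sym ρP≈1))
      (solve 5 (λ r a q b f → r :* (a :* q :+ b) :- r :* (a :* f :+ b) := r :* (a :* (q :- f))) refl ρ A Q B (F (toℕ p) (toℕ q)))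

    M-pattern : IsPattern b M
    M-pattern = record
      { symmetric   = λ p q → *-congˡ (+-congʳ (*-congˡ (F-comm (toℕ p) (toℕ q))))
      ; nonnegative = λ p q → *-nonneg 0≤ρ (+-nonneg (*-nonneg (<⇒≤ 0<A) (F-nonneg (toℕ p) (toℕ q))) 0≤B)
      ; ≤1          = λ p q → 0≤y-x⇒x≤y (≤.trans
          (*-nonneg 0≤ρ (*-nonneg (<⇒≤ 0<A) (0≤y-x (F≤Q (toℕ p) (toℕ q))))) (≤.reflexive (sym (1-M≈ p q))))
      ; diagonal    = λ p → trans (*-congˡ (+-congʳ (*-congˡ (F-diagonal (toℕ p))))) ρP≈1
      ; rowSum      = M-rowSum
      ; spread      = ≈-resp spread≈ (scale (*-nonneg 0≤ρ (<⇒≤ 0<A)) (covariance-Gram {n} (λ x p → v (toℕ p) x)))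
      }
      where
      open SetoidReasoning setoid
      ν = fromℕ n
      F-rowSum : ∀ (p : Fin n) → ∑[ q < n ] F (toℕ p) (toℕ q) ≈ S * S
      F-rowSum p = begin
        ∑[ q < n ] F (toℕ p) (toℕ q)                   ≈⟨ ⟪,∑⟫ (v (toℕ p)) (λ (q : Fin n) → v (toℕ q)) ⟨
        ⟪ v (toℕ p) , (λ x → ∑[ q < n ] v (toℕ q) x) ⟫ ≈⟨ (∑-cong λ x → *-congˡ (v-columnMass x)) ⟩
        ∑[ x < n ] (v (toℕ p) x * S)                   ≈⟨ ∑-*ʳ (v (toℕ p)) S ⟩
        (∑[ x < n ] v (toℕ p) x) * S                   ≈⟨ *-congʳ (v-mass (toℕ p)) ⟩
        S * S                                          ∎
      M-rowSum : RowSum M b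
      M-rowSum p = begin
        ∑[ q < n ] M p q
          ≈⟨ ∑-*ˡ {n} ρ (λ q → A * F (toℕ p) (toℕ q) + B) ⟩
        ρ * ∑[ q < n ] (A * F (toℕ p) (toℕ q) + B)
          ≈⟨ *-congˡ (∑-distrib-+ {n} (λ q → A * F (toℕ p) (toℕ q)) (λ _ → B)) ⟩
        ρ * (∑[ q < n ] (A * F (toℕ p) (toℕ q)) + ∑[ q < n ] B)
          ≈⟨ *-congˡ (+-cong (trans (∑-*ˡ A (λ (q : Fin n) → F (toℕ p) (toℕ q))) (*-congˡ (F-rowSum p))) (∑-const n B)) ⟩
        ρ * (A * (S * S) + ν * B)
          ≈⟨ solve 5 (λ r n b s q → r :* ((n :- b) :* (s :* s) :+ n :* (b :* q :- s :* s)) :=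
               r :* ((n :- b) :* q :+ (b :* q :- s :* s)) :* b) refl ρ ν b S Q ⟩
        ρ * P * b
          ≈⟨ trans (*-congʳ ρP≈1) (*-identityˡ b) ⟩
        b ∎
      F′ : Matrix n n
      F′ p q = F (toℕ p) (toℕ q)
      mass : Vector Carrier n
      mass p = ∑[ x < n ] v (toℕ p) x
      spread≈ : ∀ p q → ρ * A * (ν * F′ p q - mass p * mass q) ≈ ν * M p q - b
      spread≈ p q = begin
        ρ * A * (ν * F′ p q - mass p * mass q)
          ≈⟨ *-congˡ (+-congˡ (-‿cong (*-cong (v-mass (toℕ p)) (v-mass (toℕ q))))) ⟩
        ρ * A * (ν * F′ p q - S * S)
          -- The relation n B - b P = - A S², which also gives the row sums, makes the constant part
          -- of M fit the covariance exactly.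
          ≈⟨ solve 6 (λ r n b s q f → r :* (n :- b) :* (n :* f :- s :* s) :=
               n :* (r :* ((n :- b) :* f :+ (b :* q :- s :* s))) :- r :* ((n :- b) :* q :+ (b :* q :- s :* s)) :* b) refl ρ ν b S Q (F′ p q) ⟩
        ν * M p q - ρ * P * b
          ≈⟨ +-congˡ (-‿cong (trans (*-congʳ ρP≈1) (*-identityˡ b))) ⟩
        ν * M p q - b ∎

    Adjacent : Fin n → Fin n → Set
    Adjacent p q = suc (toℕ p) % n ≡ toℕ q % n

    Adjacent⇒1-M≤δ : ∀ p q → Adjacent p q → 1# - M p q ≤ δ
    Adjacent⇒1-M≤δ p q adj = begin
      1# - M p q                                 ≈⟨ 1-M≈ p q ⟩
      ρ * (A * (Q - F (toℕ p) (toℕ q)))          ≈⟨ *-congˡ (*-congˡ (+-congˡ (-‿cong F≈))) ⟩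
      ρ * (A * (Q - F (suc (toℕ p)) (toℕ p)))    ≤⟨ *-monoʳ-≤ 0≤ρ (*-monoʳ-≤ (<⇒≤ 0<A) (Q-F≤η (toℕ p))) ⟩
      δ                                          ∎
      where
      open ≤-Reasoning
      F≈ : F (toℕ p) (toℕ q) ≈ F (suc (toℕ p)) (toℕ p)
      F≈ = trans (F-comm (toℕ p) (toℕ q)) (⟪⟫-cong {f = v (toℕ q)} {g = v (toℕ p)} (v-periodic (toℕ q) (suc (toℕ p)) (≡.sym adj)) (λ _ → refl))

    -- Here δ = A η / P, while P ≥ A Q and Q ≥ η³ / 2; the factor A cancels, so the bound does not
    -- depend on n.
    ηηδ≤2 : η * η * δ ≤ 2#
    ηηδ≤2 = begin
      η * η * δ                ≈⟨ solve 3 (λ e r a → e :* e :* (r :* (a :* e)) := r :* a :* (e :* e :* e)) refl η ρ A ⟩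
      ρ * A * (η * η * η)      ≤⟨ *-monoʳ-≤ (*-nonneg 0≤ρ (<⇒≤ 0<A)) η³≤2Q ⟩
      ρ * A * (2# * Q)         ≤⟨ ≤-by (*-nonneg (<⇒≤ 0<2) (*-nonneg 0≤ρ 0≤B))
                                    (solve 5 (λ r a q b t → t :* (r :* (a :* q :+ b)) := r :* a :* (t :* q) :+ t :* (r :* b)) refl ρ A Q B 2#) ⟩
      2# * (ρ * P)             ≈⟨ trans (*-congˡ ρP≈1) (*-identityʳ 2#) ⟩
      2#                       ∎
      where open ≤-Reasoning

  -- Cycles, labelled vertices and tours

  module _ {n : ℕ} where

    C₁-nonneg : ∀ i j → 0# ≤ C₁ n i j
    C₁-nonneg i j = 𝟙-nonneg (next i ≟ j ⊎-dec next j ≟ i)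

    C₁-symmetric : ∀ i j → C₁ n i j ≡ C₁ n j i
    C₁-symmetric i j = 𝟙-cong (next i ≟ j ⊎-dec next j ≟ i) (next j ≟ i ⊎-dec next i ≟ j) Sum.swap Sum.swap

    𝟙-⊎ : ∀ {P Q : Set} (P? : Dec P) (Q? : Dec Q) → 𝟙 (P? ⊎-dec Q?) ≤ 𝟙 P? + 𝟙 Q?
    𝟙-⊎ (yes p) Q? = ≤-by (𝟙-nonneg Q?) refl
    𝟙-⊎ (no ¬p) Q? = ≤.trans (𝟙-mono (no ¬p ⊎-dec Q?) Q? λ { (inj₁ p) → ⊥-elim (¬p p) ; (inj₂ q) → q })
      (≤.reflexive (sym (+-identityˡ _)))

    C₁-degree : ∀ i → ∑[ j < suc n ] C₁ n i j ≤ 2#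
    C₁-degree i = begin
      ∑[ j < suc n ] C₁ n i j                               ≤⟨ (∑-mono-≤ λ j → 𝟙-⊎ (next i ≟ j) (next j ≟ i)) ⟩
      ∑[ j < suc n ] (𝟙 (next i ≟ j) + 𝟙 (next j ≟ i))      ≈⟨ ∑-distrib-+ (λ j → 𝟙 (next i ≟ j)) (λ j → 𝟙 (next j ≟ i)) ⟩
      ∑[ j < suc n ] 𝟙 (next i ≟ j) + ∑[ j < suc n ] 𝟙 (next j ≟ i)
        ≈⟨ +-cong (trans (∑-cong λ j → reflexive (≟-sym (next i) j)) (∑-𝟙≈1 (next i)))
                  -- Shifted by one, the column mass of `point` counts the predecessors of i, of
                  -- which there is one.
                  (trans (∑-cong λ j → reflexive (predecessor j)) (point-columnMass 1 i)) ⟩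
      2#                                                    ∎
      where
      open ≤-Reasoning
      predecessor : ∀ j → 𝟙 (next j ≟ i) ≡ 𝟙 (i ≟ (toℕ j ℕ.+ 1) mod suc n)
      predecessor j = ≡.trans (≟-sym (next j) i) (≡.cong (λ k → 𝟙 (i ≟ k mod suc n)) (ℕ.+-comm 1 (toℕ j)))

    ∑-punchIn-≤ : ∀ (i : Fin (suc n)) (f : Vector Carrier (suc n)) → (∀ j → 0# ≤ f j) →
                  ∑[ j < n ] f (punchIn i j) ≤ sum f
    ∑-punchIn-≤ i f 0≤f = ≤-by (0≤f i) (trans (sum-remove {i = i} f) (+-comm _ _))

    C₁-degree-punchIn : ∀ (r i : Fin (suc n)) → ∑[ q < n ] C₁ n i (punchIn r q) ≤ 2#
    C₁-degree-punchIn r i = ≤.trans (∑-punchIn-≤ r (C₁ n i) (C₁-nonneg i)) (C₁-degree i)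

    toℕ-next : ∀ (i : Fin (suc n)) → toℕ (next i) ≡ suc (toℕ i) ⊎ (toℕ i ≡ n × toℕ (next i) ≡ 0)
    toℕ-next i with ℕ.m≤n⇒m<n∨m≡n (ℕ.s≤s⁻¹ (toℕ<n i))
    ... | inj₁ i<n = inj₁ (≡.trans (toℕ-mod (suc (toℕ i))) (m<n⇒m%n≡m (ℕ.s≤s i<n)))
    ... | inj₂ i≡n = inj₂ (i≡n , ≡.trans (toℕ-mod (suc (toℕ i))) (≡.trans (≡.cong (λ k → suc k % suc n) i≡n) (n%n≡0 (suc n))))

    next-mod : ∀ m → next (m mod suc n) ≡ suc m mod suc n
    next-mod m = %⇒mod (suc (toℕ (m mod suc n))) (suc m) (%-congˡ-+ (suc n) 1 (toℕ (m mod suc n)) m (≡.trans (≡.cong (_% suc n) (toℕ-mod m)) (m%n%n≡m%n m (suc n))))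

    -- From i, suc n - i steps lead around to position 0, and j more lead to j.
    next-closed⇒all : ∀ {P : Fin (suc n) → Set} → (∀ i → P i → P (next i)) → ∀ {i} → P i → ∀ j → P j
    next-closed⇒all {P} P-next {i} Pi j = ≡.subst P reaches (iterate (toℕ j ℕ.+ (suc n ℕ.∸ toℕ i)))
      where
      iterate : ∀ k → P ((k ℕ.+ toℕ i) mod suc n)
      iterate zero    = ≡.subst P (≡.sym (mod-toℕ i)) Pi
      iterate (suc k) = ≡.subst P (next-mod (k ℕ.+ toℕ i)) (P-next _ (iterate k))
      reaches : (toℕ j ℕ.+ (suc n ℕ.∸ toℕ i) ℕ.+ toℕ i) mod suc n ≡ j
      reaches = ≡.trans (%⇒mod (toℕ j ℕ.+ (suc n ℕ.∸ toℕ i) ℕ.+ toℕ i) (toℕ j) (≡.trans (≡.cong (_% suc n)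
        (≡.trans (ℕ.+-assoc (toℕ j) (suc n ℕ.∸ toℕ i) (toℕ i)) (≡.cong (toℕ j ℕ.+_) (ℕ.m∸n+n≡m (toℕ≤n i))))) ([m+n]%n≡m%n (toℕ j) (suc n)))) (mod-toℕ j)

  toℕ-punchIn : ∀ {n} (r : Fin (suc n)) (p : Fin n) →
    (toℕ p ℕ.< toℕ r × toℕ (punchIn r p) ≡ toℕ p) ⊎ (toℕ r ℕ.≤ toℕ p × toℕ (punchIn r p) ≡ suc (toℕ p))
  toℕ-punchIn zero    p       = inj₂ (ℕ.z≤n , ≡.refl)
  toℕ-punchIn (suc r) zero    = inj₁ (ℕ.s≤s ℕ.z≤n , ≡.refl)
  toℕ-punchIn (suc r) (suc p) with toℕ-punchIn r p
  ... | inj₁ (p<r , eq) = inj₁ (ℕ.s≤s p<r , ≡.cong suc eq)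
  ... | inj₂ (r≤p , eq) = inj₂ (ℕ.s≤s r≤p , ≡.cong suc eq)

  -- Deleting a vertex from the cycle and closing up the gap gives a shorter cycle.
  next-punchIn : ∀ {n} .{{_ : NonZero n}} (r : Fin (suc n)) (p q : Fin n) →
                 next (punchIn r p) ≡ punchIn r q → suc (toℕ p) % n ≡ toℕ q % n
  next-punchIn {n} r p q eq with toℕ-next (punchIn r p) | toℕ-punchIn r p | toℕ-punchIn r q
  ... | inj₁ step | inj₁ (p<r , αp) | inj₁ (q<r , αq) = ≡.cong (_% n)
    (≡.trans (≡.cong suc (≡.sym αp)) (≡.trans (≡.sym step) (≡.trans (≡.cong toℕ eq) αq)))
  -- A step from below r to above r would skip r itself: it forces p = q, against p < r ≤ q.
  ... | inj₁ step | inj₁ (p<r , αp) | inj₂ (r≤q , αq) = ⊥-elim (ℕ.<-irrefl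
    (ℕ.suc-injective (≡.trans (≡.cong suc (≡.sym αp)) (≡.trans (≡.sym step) (≡.trans (≡.cong toℕ eq) αq))))
    (ℕ.<-≤-trans p<r r≤q))
  ... | inj₁ step | inj₂ (r≤p , αp) | inj₁ (q<r , αq) = ⊥-elim (ℕ.<-irrefl
    (≡.trans (≡.sym αq) (≡.trans (≡.cong toℕ (≡.sym eq)) (≡.trans step (≡.cong suc αp))))
    (ℕ.<-≤-trans q<r (ℕ.≤-trans r≤p (ℕ.≤-trans (ℕ.n≤1+n _) (ℕ.n≤1+n _)))))
  ... | inj₁ step | inj₂ (r≤p , αp) | inj₂ (r≤q , αq) = ≡.cong (_% n)
    (ℕ.suc-injective (≡.trans (≡.cong suc (≡.sym αp)) (≡.trans (≡.sym step) (≡.trans (≡.cong toℕ eq) αq))))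
  ... | inj₂ (αp≡n , _) | inj₁ (p<r , αp) | _ = ⊥-elim (ℕ.<-irrefl (≡.trans (≡.sym αp) αp≡n) (toℕ<n p))
  -- The wrap-around edge: suc p = n and q = 0, which are congruent modulo n.
  ... | inj₂ (αp≡n , step) | inj₂ (r≤p , αp) | inj₁ (q<r , αq) = ≡.trans
    (≡.cong (_% n) (≡.trans (≡.sym αp) αp≡n))
    (≡.trans (n%n≡0 n) (≡.trans (≡.sym (m<n⇒m%n≡m (ℕ.≤-<-trans ℕ.z≤n (toℕ<n p))))
      (≡.cong (_% n) (≡.trans (≡.sym step) (≡.trans (≡.cong toℕ eq) αq)))))
  ... | inj₂ (αp≡n , step) | inj₂ (r≤p , αp) | inj₂ (r≤q , αq)
    with () ← ≡.trans (≡.sym step) (≡.trans (≡.cong toℕ eq) αq)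

  another : ∀ {g} → 2 ℕ.≤ g → (γ : Fin g) → ∃[ γ′ ] γ′ ≢ γ
  another (ℕ.s≤s (ℕ.s≤s _)) zero    = suc zero , λ ()
  another (ℕ.s≤s (ℕ.s≤s _)) (suc _) = zero , λ ()

  -- Tours on labelled vertices

  module Labels {n g : ℕ} (label : Fin (suc n) → Fin g) where

    D : Matrix (suc n) (suc n)
    D x y = 1# - 𝟙 (label x ≟ label y)

    D≤1 : ∀ x y → D x y ≤ 1#
    D≤1 x y = ≤-by (𝟙-nonneg (label x ≟ label y))
      (solve 1 (λ e → :1 := (:1 :- e) :+ e) refl (𝟙 (label x ≟ label y)))

    D-isInstance : IsInstance D
    D-isInstance = record
      { symmetric   = λ x y → +-congˡ (-‿cong (reflexive (≟-sym (label x) (label y))))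
      ; nonnegative = λ x y → 0≤y-x (𝟙-≤1 (label x ≟ label y))
      ; diagonal    = λ x → trans (+-congˡ (-‿cong (reflexive (𝟙-yes (label x ≟ label x) ≡.refl)))) (-‿inverseʳ 1#)
      ; triangle    = λ x y z → triangle (label x) (label y) (label z)
      }
      where
      triangle : ∀ (a b c : Fin g) → 1# - 𝟙 (a ≟ b) ≤ (1# - 𝟙 (a ≟ c)) + (1# - 𝟙 (c ≟ b))
      triangle a b c with a ≟ c
      ... | yes ≡.refl = ≤-by ≤.refl (solve 1 (λ e → (:1 :- :1) :+ (:1 :- e) := (:1 :- e) :+ :0) refl (𝟙 (a ≟ b)))
      ... | no _       = ≤-by (+-nonneg (𝟙-nonneg (a ≟ b)) (0≤y-x (𝟙-≤1 (c ≟ b))))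
        (solve 2 (λ e f → (:1 :- :0) :+ (:1 :- f) := (:1 :- e) :+ (e :+ (:1 :- f))) refl (𝟙 (a ≟ b)) (𝟙 (c ≟ b)))

    ∑-natural : ∀ {m} (f : Vector Carrier m) → (∀ i → ∃[ k ] f i ≈ fromℕ k) → ∃[ k ] sum f ≈ fromℕ k
    ∑-natural {zero}  f f-nat = 0 , refl
    ∑-natural {suc m} f f-nat with f-nat zero | ∑-natural (f ∘ suc) (f-nat ∘ suc)
    ... | k , f₀≈k | l , ∑≈l = k ℕ.+ l , trans (+-cong f₀≈k ∑≈l) (sym (fromℕ-+ k l))

    -- Integrality lets a cheapest tour be found by well-founded descent on the cost, without
    -- enumerating permutations.
    tourCost-natural : ∀ σ → ∃[ k ] tourCost D σ ≈ fromℕ k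
    tourCost-natural σ = ∑-natural _ (λ i → natural (label (σ ⟨$⟩ʳ i) ≟ label (σ ⟨$⟩ʳ next i)))
      where
      natural : ∀ {P : Set} (P? : Dec P) → ∃[ k ] 1# - 𝟙 P? ≈ fromℕ k
      natural (yes _) = 0 , -‿inverseʳ 1#
      natural (no _)  = 1 , +-congˡ -0#≈0#

    module _ (2≤g : 2 ℕ.≤ g) (label-surjective : ∀ γ → ∃[ x ] label x ≡ γ) where

      module _ (σ : Permutation′ (suc n)) where

        leaves : Fin g → Fin (suc n) → Carrier
        leaves γ i = 𝟙 (label (σ ⟨$⟩ʳ i) ≟ γ) * (1# - 𝟙 (label (σ ⟨$⟩ʳ next i) ≟ γ))

        leaves-nonneg : ∀ γ i → 0# ≤ leaves γ i
        leaves-nonneg γ i = *-nonneg (𝟙-nonneg (label (σ ⟨$⟩ʳ i) ≟ γ)) (0≤y-x (𝟙-≤1 (label (σ ⟨$⟩ʳ next i) ≟ γ)))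

        -- A tour that never left γ would stay in it forever once inside, yet it also visits a
        -- vertex of another group.
        label-left : ∀ γ → ∃[ i ] (label (σ ⟨$⟩ʳ i) ≡ γ × label (σ ⟨$⟩ʳ next i) ≢ γ)
        label-left γ = decidable-stable
          (any? λ i → (label (σ ⟨$⟩ʳ i) ≟ γ) ×-dec ¬? (label (σ ⟨$⟩ʳ next i) ≟ γ))
          λ never → proj₂ (another 2≤g γ) (everywhere never (proj₁ (another 2≤g γ)))
          where
          visited : ∀ γ → ∃[ i ] label (σ ⟨$⟩ʳ i) ≡ γ
          visited γ with label-surjective γ
          ... | x , x∈γ = σ ⟨$⟩ˡ x , ≡.trans (≡.cong label (inverseʳ σ)) x∈γ
          everywhere : ¬ (∃[ i ] (label (σ ⟨$⟩ʳ i) ≡ γ × label (σ ⟨$⟩ʳ next i) ≢ γ)) → ∀ γ′ → γ′ ≡ γ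
          everywhere never γ′ with visited γ′
          ... | i , i∈γ′ = ≡.trans (≡.sym i∈γ′) (next-closed⇒all {P = λ i → label (σ ⟨$⟩ʳ i) ≡ γ}
            (λ i i∈γ → decidable-stable (label (σ ⟨$⟩ʳ next i) ≟ γ) λ i⁺∉γ → never (i , i∈γ , i⁺∉γ))
            (proj₂ (visited γ)) i)

        -- A step costs one precisely when it leaves the group of its starting point, so the
        -- departures summed over all groups are the cost, and each group has at least one.
        tourCost-≥ : fromℕ g ≤ tourCost D σ
        tourCost-≥ = begin
          fromℕ g                                       ≈⟨ trans (∑-const g 1#) (*-identityʳ _) ⟨
          ∑[ γ < g ] 1#                                 ≤⟨ (∑-mono-≤ once) ⟩
          ∑[ γ < g ] ∑[ i < suc n ] leaves γ i          ≈⟨ ∑-comm leaves ⟩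
          ∑[ i < suc n ] ∑[ γ < g ] leaves γ i
            ≈⟨ (∑-cong λ i → trans (∑-𝟙′ (label (σ ⟨$⟩ʳ i)) (λ γ → 1# - 𝟙 (label (σ ⟨$⟩ʳ next i) ≟ γ)))
                 (+-congˡ (-‿cong (reflexive (≟-sym (label (σ ⟨$⟩ʳ next i)) (label (σ ⟨$⟩ʳ i))))))) ⟩
          tourCost D σ                                  ∎
          where
          open ≤-Reasoning
          once : ∀ γ → 1# ≤ ∑[ i < suc n ] leaves γ i
          once γ with label-left γ
          ... | i , i∈γ , i⁺∉γ = ≤.trans
            (≤.reflexive (sym (trans (*-cong (reflexive (𝟙-yes (label (σ ⟨$⟩ʳ i) ≟ γ) i∈γ))
                                             (+-congˡ (-‿cong (reflexive (𝟙-no (label (σ ⟨$⟩ʳ next i) ≟ γ) i⁺∉γ)))))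
              (solve 0 (:1 :* (:1 :- :0) := :1) refl))))
            (term≤∑ {f = leaves γ} (leaves-nonneg γ) i)

    IsOPT-TSP-exists : ExcludedMiddle 0ℓ → ∃[ t ] IsOPT-TSP D t
    IsOPT-TSP-exists em = attained (descend _ Permutation.id ≡.refl)
      where
      cost : Permutation′ (suc n) → ℕ
      cost σ = proj₁ (tourCost-natural σ)
      descend : ∀ k σ → cost σ ≡ k → ∃[ σ ] (∀ τ → cost σ ℕ.≤ cost τ)
      descend = <-rec _ λ k rec σ σ-cost → step k rec σ σ-cost
        where
        step : ∀ k → (∀ {l} → l ℕ.< k → ∀ σ → cost σ ≡ l → ∃[ σ ] (∀ τ → cost σ ℕ.≤ cost τ)) →
               ∀ σ → cost σ ≡ k → ∃[ σ ] (∀ τ → cost σ ℕ.≤ cost τ)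
        step k rec σ ≡.refl with em {∃[ τ ] cost τ ℕ.< cost σ}
        ... | yes (τ , τ<σ) = rec τ<σ τ ≡.refl
        ... | no ¬better    = σ , λ τ → ℕ.≮⇒≥ λ τ<σ → ¬better (τ , τ<σ)
      attained : ∃[ σ ] (∀ τ → cost σ ℕ.≤ cost τ) → ∃[ t ] IsOPT-TSP D t
      attained (σ , σ-min) = tourCost D σ , (σ , refl) , λ c (τ , τ≈c) → begin
        tourCost D σ     ≈⟨ proj₂ (tourCost-natural σ) ⟩
        fromℕ (cost σ)   ≤⟨ fromℕ-mono-≤ (σ-min τ) ⟩
        fromℕ (cost τ)   ≈⟨ proj₂ (tourCost-natural τ) ⟨
        tourCost D τ     ≈⟨ τ≈c ⟩
        c                ∎
        where open ≤-Reasoning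

  -- The row sum is given up to `≈` because the hats use `η + η`, which is not literally the image
  -- of `h + h`.
  module Groups {g c : ℕ} {b : Carrier} (c≈b : fromℕ c ≈ b) where
    private
      n : ℕ
      n = g ℕ.* c

    group : Fin n → Fin g
    group = quotient c

    G : Matrix n n
    G i j = 𝟙 (group i ≟ group j)

    G-pattern : IsPattern b G
    G-pattern = record
      { symmetric   = λ i j → reflexive (≟-sym (group i) (group j))
      ; nonnegative = λ i j → 𝟙-nonneg (group i ≟ group j)
      ; ≤1          = λ i j → 𝟙-≤1 (group i ≟ group j)
      ; diagonal    = λ i → reflexive (𝟙-yes (group i ≟ group i) ≡.refl)
      ; rowSum      = rowSum
      -- The samples are the indicators of the g groups. Each vertex lies in one group, so their
      -- covariance is g G - J, and c times it is n G - b J.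
      ; spread      = ≈-resp spread≈ (scale (fromℕ-nonneg c) (covariance-Gram {g} (λ γ i → 𝟙 (γ ≟ group i))))
      }
      where
      open SetoidReasoning setoid
      rowSum : RowSum G b
      rowSum i = begin
        ∑[ j < n ] G i j                           ≈⟨ ∑-remQuot g c (λ γ _ → 𝟙 (group i ≟ γ)) ⟩
        ∑[ γ < g ] ∑[ _ < c ] 𝟙 (group i ≟ γ)      ≈⟨ (∑-cong λ γ → trans (∑-const c (𝟙 (group i ≟ γ))) (*-comm _ _)) ⟩
        ∑[ γ < g ] (𝟙 (group i ≟ γ) * fromℕ c)     ≈⟨ ∑-𝟙′ (group i) (λ _ → fromℕ c) ⟩
        fromℕ c                                    ≈⟨ c≈b ⟩
        b                                          ∎
      spread≈ : ∀ i j → fromℕ c * (fromℕ g * ∑[ γ < g ] (𝟙 (γ ≟ group i) * 𝟙 (γ ≟ group j))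
                  - (∑[ γ < g ] 𝟙 (γ ≟ group i)) * (∑[ γ < g ] 𝟙 (γ ≟ group j))) ≈ fromℕ n * G i j - b
      spread≈ i j = begin
        fromℕ c * (fromℕ g * ∑[ γ < g ] (𝟙 (γ ≟ group i) * 𝟙 (γ ≟ group j))
          - (∑[ γ < g ] 𝟙 (γ ≟ group i)) * (∑[ γ < g ] 𝟙 (γ ≟ group j)))
          ≈⟨ *-congˡ (+-cong (*-congˡ (∑-𝟙 (group i) (λ γ → 𝟙 (γ ≟ group j))))
                             (-‿cong (*-cong (∑-𝟙≈1 (group i)) (∑-𝟙≈1 (group j))))) ⟩
        fromℕ c * (fromℕ g * G i j - 1# * 1#)
          ≈⟨ solve 3 (λ c g x → c :* (g :* x :- :1 :* :1) := g :* c :* x :- c) refl (fromℕ c) (fromℕ g) (G i j) ⟩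
        fromℕ g * fromℕ c * G i j - fromℕ c
          ≈⟨ +-cong (*-congʳ (sym (fromℕ-* g c))) (-‿cong c≈b) ⟩
        fromℕ n * G i j - b ∎

  -- The minimum of the semidefinite program is attained

  Near : Carrier → Carrier → Carrier → Set
  Near ε x y = x ≤ y + ε × y ≤ x + ε

  Near-mono : ∀ {ε ε′ x y} → ε ≤ ε′ → Near ε x y → Near ε′ x y
  Near-mono ε≤ε′ (x≤y+ε , y≤x+ε) = ≤.trans x≤y+ε (+-mono-≤ ≤.refl ε≤ε′) , ≤.trans y≤x+ε (+-mono-≤ ≤.refl ε≤ε′)

  Near-sym : ∀ {ε x y} → Near ε x y → Near ε y x
  Near-sym (x≤y+ε , y≤x+ε) = y≤x+ε , x≤y+ε

  x-ε<x : ∀ {x ε} → 0# < ε → x - ε < x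
  x-ε<x {x} {ε} 0<ε x≤x-ε = 0<ε (begin
    ε             ≤⟨ ≤-by (0≤y-x x≤x-ε) (solve 2 (λ x e → :0 := e :+ ((x :- e) :- x)) refl x ε) ⟩
    0#            ∎)
    where open ≤-Reasoning

  x<x+ε : ∀ {x ε} → 0# < ε → x < x + ε
  x<x+ε {x} {ε} 0<ε x+ε≤x = 0<ε (≤-by (0≤y-x x+ε≤x) (solve 2 (λ x e → :0 := e :+ (x :- (x :+ e))) refl x ε))

  min-pos : ∀ {x y} → 0# < x → 0# < y → ∃[ m ] (0# < m × m ≤ x × m ≤ y)
  min-pos {x} {y} 0<x 0<y with ≤.total x y
  ... | inj₁ x≤y = x , 0<x , ≤.refl , x≤y
  ... | inj₂ y≤x = y , 0<y , y≤x , ≤.refl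

  module Compactness (em : ExcludedMiddle 0ℓ) where

    -- Taken as the supremum of the lower bounds.
    infimum : (P : Carrier → Set) → (∃[ x ] P x) → (∀ x → P x → 0# ≤ x) →
      ∃[ v ] ((∀ x → P x → v ≤ x) × (∀ ε → 0# < ε → ∃[ x ] (P x × x ≤ v + ε)))
    infimum P (x₀ , Px₀) 0≤P with complete (λ t → ∀ x → P x → t ≤ x) (0# , 0≤P) (x₀ , λ t t≤P → t≤P x₀ Px₀)
    ... | v , v-ub , v-least = v , (λ x Px → v-least x λ t t≤P → t≤P x Px) , approximated
      where
      approximated : ∀ ε → 0# < ε → ∃[ x ] (P x × x ≤ v + ε)
      approximated ε 0<ε = decidable-stable em λ none →
        x<x+ε 0<ε (v-ub (v + ε) λ x Px → <⇒≤ λ x≤v+ε → none (x , Px , x≤v+ε))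

    module _ {A : Set} where

      -- A nested family indexed by ε stands in for a sequence: limits are taken along it without
      -- choosing terms or passing to subsequences.
      Shrinking Inhabited : (Carrier → A → Set) → Set
      Shrinking P = ∀ {ε ε′ a} → ε ≤ ε′ → P ε a → P ε′ a
      Inhabited P = ∀ ε → 0# < ε → ∃[ a ] P ε a

      -- The limit inferior of c along the shrinking sets P ε.
      clusterValue : (P : Carrier → A → Set) → Shrinking P → Inhabited P →
        (c : A → Carrier) (u : Carrier) → (∀ {ε a} → P ε a → 0# ≤ c a × c a ≤ u) →
        ∃[ x ] Inhabited (λ ε a → P ε a × Near ε (c a) x)
      clusterValue P shrink inhabited c u bounds with
        complete (λ t → ∃[ ε ] (0# < ε × (∀ a → P ε a → t ≤ c a)))
                 (0# , 1# , 0<1 , λ a Pa → proj₁ (bounds Pa))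
                 (u , λ t (ε , 0<ε , t≤c) → let (a , Pa) = inhabited ε 0<ε in ≤.trans (t≤c a Pa) (proj₂ (bounds Pa)))
      ... | x , x-ub , x-least = x , near
        where
        near : Inhabited (λ ε a → P ε a × Near ε (c a) x)
        near ε 0<ε
          with t , (ε₁ , 0<ε₁ , t≤c) , x-ε<t ← decidable-stable (em {∃[ t ] ((∃[ ε ] (0# < ε × (∀ a → P ε a → t ≤ c a))) × x - ε < t)})
                 (λ none → x-ε<x 0<ε (x-least (x - ε) λ t t∈ → decidable-stable em λ t≰x-ε → none (t , t∈ , t≰x-ε)))
          -- In P μ the lower bound t holds by μ ≤ ε₁. Some value there lies below x + ε, as
          -- otherwise x + ε would be one of the numbers whose supremum is x.
          with μ , 0<μ , μ≤ε , μ≤ε₁ ← min-pos 0<ε 0<ε₁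
          with a , Pa , ca<x+ε ← decidable-stable (em {∃[ a ] (P μ a × c a < x + ε)})
                 (λ none → x<x+ε 0<ε (x-ub (x + ε) (μ , 0<μ , λ a Pa → decidable-stable em λ x+ε≰ca → none (a , Pa , x+ε≰ca))))
          = a , shrink μ≤ε Pa , <⇒≤ ca<x+ε , ≤.trans (≤.reflexive (solve 2 (λ x e → x := (x :- e) :+ e) refl x ε))
              (+-mono-≤ (≤.trans (<⇒≤ x-ε<t) (t≤c a (shrink μ≤ε₁ Pa))) ≤.refl)

      -- Being near the limit of the first coordinate is added to the family, which stays shrinking
      -- and inhabited; the other limits are taken inside it, as with successive subsequences.
      clusterPoint : ∀ {m} (P : Carrier → A → Set) → Shrinking P → Inhabited P →
        (c : Fin m → A → Carrier) (u : Carrier) → (∀ {ε a} → P ε a → ∀ i → 0# ≤ c i a × c i a ≤ u) →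
        ∃ λ (x : Vector Carrier m) → Inhabited (λ ε a → P ε a × (∀ i → Near ε (c i a) (x i)))
      clusterPoint {zero} P shrink inhabited c u bounds =
        (λ ()) , λ ε 0<ε → proj₁ (inhabited ε 0<ε) , proj₂ (inhabited ε 0<ε) , λ ()
      clusterPoint {suc m} P shrink inhabited c u bounds =
        extend (clusterValue P shrink inhabited (c zero) u (λ Pa → bounds Pa zero))
        where
        Goal : Set
        Goal = ∃ λ (x : Vector Carrier (suc m)) → Inhabited (λ ε a → P ε a × (∀ i → Near ε (c i a) (x i)))
        extend : ∃[ x₀ ] Inhabited (λ ε a → P ε a × Near ε (c zero a) x₀) → Goal
        extend (x₀ , inhabited₀) = combined
          (clusterPoint P′ shrink′ inhabited₀ (c ∘ suc) u (λ P′a i → bounds (proj₁ P′a) (suc i)))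
          where
          P′ : Carrier → A → Set
          P′ ε a = P ε a × Near ε (c zero a) x₀
          shrink′ : Shrinking P′
          shrink′ ε≤ε′ (Pa , near) = shrink ε≤ε′ Pa , Near-mono ε≤ε′ near
          combined : (∃ λ (x : Vector Carrier m) → Inhabited (λ ε a → P′ ε a × (∀ i → Near ε (c (suc i) a) (x i)))) → Goal
          combined (x , inhabited′) = x₀ ∷ x , λ ε 0<ε → near (inhabited′ ε 0<ε)
            where
            near : ∀ {ε} → ∃[ a ] (P′ ε a × (∀ i → Near ε (c (suc i) a) (x i))) →
                   ∃[ a ] (P ε a × (∀ i → Near ε (c i a) ((x₀ ∷ x) i)))
            near (a , (Pa , near₀) , near₊) = a , Pa , λ { zero → near₀ ; (suc i) → near₊ i }

    -- Lipschitz functionals and closed conditions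

    module _ {k l : ℕ} where

      NearMatrix : Carrier → Matrix k l → Matrix k l → Set
      NearMatrix ε Y Z = ∀ i j → Near ε (Y i j) (Z i j)

      -- One inequality suffices, since nearness is symmetric. Constraints and objective are linear
      -- in the entries, so a few closure rules cover them all.
      Lipschitz : (Matrix k l → Carrier) → Set
      Lipschitz φ = ∃[ K ] (0# ≤ K × (∀ {ε Y Z} → NearMatrix ε Y Z → φ Y ≤ φ Z + K * ε))

      Lipschitz-entry : ∀ i j → Lipschitz (λ Y → Y i j)
      Lipschitz-entry i j = 1# , 0≤1 , λ near → ≤.trans (proj₁ (near i j)) (+-mono-≤ ≤.refl (≤.reflexive (sym (*-identityˡ _))))

      Lipschitz-resp : ∀ {φ ψ} → (∀ Y → φ Y ≈ ψ Y) → Lipschitz φ → Lipschitz ψ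
      Lipschitz-resp φ≈ψ (K , 0≤K , φ-lip) = K , 0≤K , λ {_} {Y} {Z} near →
        ≤.trans (≤.reflexive (sym (φ≈ψ Y))) (≤.trans (φ-lip near) (+-mono-≤ (≤.reflexive (φ≈ψ Z)) ≤.refl))

      Lipschitz-zero : Lipschitz (λ _ → 0#)
      Lipschitz-zero = 0# , ≤.refl , λ {ε} _ → ≤.reflexive (sym (trans (+-identityˡ _) (zeroˡ ε)))

      Lipschitz-+ : ∀ {φ ψ} → Lipschitz φ → Lipschitz ψ → Lipschitz (λ Y → φ Y + ψ Y)
      Lipschitz-+ {φ} {ψ} (K , 0≤K , φ-lip) (L , 0≤L , ψ-lip) = K + L , +-nonneg 0≤K 0≤L , λ {ε} {Y} {Z} near →
        ≤.trans (+-mono-≤ (φ-lip near) (ψ-lip near)) (≤.reflexive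
          (solve 5 (λ a b k l e → (a :+ k :* e) :+ (b :+ l :* e) := (a :+ b) :+ (k :+ l) :* e) refl (φ Z) (ψ Z) K L ε))

      Lipschitz-*ˡ : ∀ c {φ} → Lipschitz φ → Lipschitz (λ Y → c * φ Y)
      Lipschitz-*ˡ c {φ} (K , 0≤K , φ-lip) with ≤.total 0# c
      ... | inj₁ 0≤c = c * K , *-nonneg 0≤c 0≤K , λ {ε} {Y} {Z} near → ≤.trans (*-monoʳ-≤ 0≤c (φ-lip near))
        (≤.reflexive (solve 4 (λ c a k e → c :* (a :+ k :* e) := c :* a :+ c :* k :* e) refl c (φ Z) K ε))
      -- A negative factor reverses the estimate, so it is applied with Y and Z exchanged.
      ... | inj₂ c≤0 = (0# - c) * K , *-nonneg (0≤y-x c≤0) 0≤K , λ {ε} {Y} {Z} near →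
        ≤-by (*-nonneg (0≤y-x c≤0) (0≤y-x (φ-lip (λ i j → Near-sym (near i j)))))
          (solve 5 (λ c a b k e → c :* b :+ (:0 :- c) :* k :* e := c :* a :+ (:0 :- c) :* ((a :+ k :* e) :- b)) refl c (φ Y) (φ Z) K ε)

      Lipschitz-*ʳ : ∀ {φ} c → Lipschitz φ → Lipschitz (λ Y → φ Y * c)
      Lipschitz-*ʳ c φ-lip = Lipschitz-resp (λ Y → *-comm c _) (Lipschitz-*ˡ c φ-lip)

      Lipschitz-∑ : ∀ {m} {φ : Fin m → Matrix k l → Carrier} → (∀ i → Lipschitz (φ i)) → Lipschitz (λ Y → ∑[ i < m ] φ i Y)
      Lipschitz-∑ {zero}  φ-lip = Lipschitz-zero
      Lipschitz-∑ {suc m} φ-lip = Lipschitz-+ (φ-lip zero) (Lipschitz-∑ (φ-lip ∘ suc))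

      -- If φ Z exceeded c by d > 0, then ε = d / (2 + K) would give d ≤ (1 + K) ε, which is less
      -- than d.
      Lipschitz-≤-closed : ∀ {φ} → Lipschitz φ → ∀ {Z c} →
        (∀ ε → 0# < ε → ∃[ Y ] (φ Y ≤ c + ε × NearMatrix ε Y Z)) → φ Z ≤ c
      Lipschitz-≤-closed {φ} (K , 0≤K , φ-lip) {Z} {c} approx = decidable-stable em contradiction
        where
        0<K+2 : 0# < 2# + K
        0<K+2 = +-pos 0<2 0≤K
        within : ∀ ε → 0# < ε → φ Z ≤ c + ε + K * ε
        within ε 0<ε with approx ε 0<ε
        ... | Y , φY≤ , near = ≤.trans (φ-lip (λ i j → Near-sym (near i j))) (+-mono-≤ φY≤ ≤.refl)
        absurd : ∀ ε → 0# < ε → (2# + K) * ε ≈ φ Z - c → ⊥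
        absurd ε 0<ε [K+2]ε≈ = 0<ε (begin
          ε                               ≈⟨ solve 2 (λ e k → e := ((:1 :+ :1) :+ k) :* e :- (e :+ k :* e)) refl ε K ⟩
          (2# + K) * ε - (ε + K * ε)      ≈⟨ +-congʳ [K+2]ε≈ ⟩
          φ Z - c - (ε + K * ε)           ≤⟨ ≤-by (0≤y-x (within ε 0<ε)) (solve 4 (λ f c e k →
                                               :0 := (f :- c :- (e :+ k :* e)) :+ ((c :+ e :+ k :* e) :- f)) refl (φ Z) c ε K) ⟩
          0#                              ∎)
          where open ≤-Reasoning
        contradiction : ¬ c < φ Z
        contradiction c<φZ = absurd ((2# + K) ⁻¹ * (φ Z - c)) (*-pos (⁻¹-pos 0<K+2) 0<d)
          (trans (sym (*-assoc _ _ _)) (trans (*-congʳ (trans (*-comm _ _) (⁻¹-inverseˡ 0<K+2))) (*-identityˡ _)))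
          where
          0<d : 0# < φ Z - c
          0<d d≤0 = c<φZ (≤-by (0≤y-x d≤0) (solve 2 (λ f c → c := f :+ (:0 :- (f :- c))) refl (φ Z) c))

    module Attainment {n : ℕ} (r s : Fin (suc n)) (D : Matrix (suc n) (suc n)) (D-nonneg : Nonnegative D) where
      open SDP₂ r s D

      private
        n² : ℕ
        n² = n ℕ.* n

      Lipschitz-trace : (W : Matrix n² n²) → Lipschitz (λ Y → trace (W *ᴹ Y))
      Lipschitz-trace W = Lipschitz-∑ λ i → Lipschitz-∑ λ k → Lipschitz-*ˡ (W i k) (Lipschitz-entry k i)

      Lipschitz-quadraticForm : ∀ x → Lipschitz (λ (Y : Matrix n² n²) → quadraticForm Y x)
      Lipschitz-quadraticForm x = Lipschitz-∑ λ i → Lipschitz-∑ λ j → Lipschitz-*ʳ (x j) (Lipschitz-*ˡ (x i) (Lipschitz-entry i j))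

      objective-nonneg : ∀ {Y} → Nonnegative Y → 0# ≤ objective Y
      objective-nonneg 0≤Y = ∑-nonneg λ x → ∑-nonneg λ y → *-nonneg (+-nonneg
        (*-nonneg (D-nonneg _ _) (*-nonneg ½-nonneg (C₁-nonneg (α (remainder {n} n x)) (α (remainder {n} n y)))))
        (Diag-nonneg x y)) (0≤Y y x)
        where
        Diag-nonneg : ∀ x y → 0# ≤ Diag c̄ x y
        Diag-nonneg x y with x ≟ y
        ... | no _  = ≤.refl
        ... | yes _ = ∑-nonneg {1} λ _ → *-nonneg (C₁-nonneg (α (remainder {n} n x)) r) (D-nonneg s (β (quotient n x)))

      -- Boundedness of the feasible set: nonnegative entries are each at most their total, which
      -- the constraint on J ⊗ J fixes.
      Feasible⇒≤n² : ∀ {Y} → Feasible Y → ∀ x y → Y x y ≤ fromℕ n²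
      Feasible⇒≤n² {Y} feasible x y = begin
        Y x y                                       ≤⟨ term≤∑ {f = λ x → Y x y} (λ x → nonnegative x y) x ⟩
        ∑[ x < n² ] Y x y                           ≤⟨ term≤∑ {f = λ y → ∑[ x < n² ] Y x y} (λ y → ∑-nonneg λ x → nonnegative x y) y ⟩
        ∑[ y < n² ] ∑[ x < n² ] Y x y
          ≈⟨ (∑-cong λ y → ∑-cong λ x → sym (trans (*-congʳ (*-identityˡ 1#)) (*-identityˡ (Y x y)))) ⟩
        trace ((J n ⊗ J n) *ᴹ Y)                    ≈⟨ trace-J⊗J ⟩
        fromℕ n²                                    ∎
        where
        open Feasible feasible
        open ≤-Reasoning

      Approximable : Matrix n² n² → Set
      Approximable Z = ∀ ε → 0# < ε → ∃[ Y ] (Feasible Y × NearMatrix ε Y Z)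

      limit-≤ : ∀ {Z φ c} → Approximable Z → Lipschitz φ → (∀ {Y} → Feasible Y → φ Y ≤ c) → φ Z ≤ c
      limit-≤ approx φ-lip φ≤c = Lipschitz-≤-closed φ-lip λ ε 0<ε →
        let (Y , feasible , near) = approx ε 0<ε in Y , ≤.trans (φ≤c feasible) (≤-by (<⇒≤ 0<ε) refl) , near

      limit-≥ : ∀ {Z φ c} → Approximable Z → Lipschitz φ → (∀ {Y} → Feasible Y → c ≤ φ Y) → c ≤ φ Z
      limit-≥ {Z} {φ} {c} approx φ-lip c≤φ = ≤-by (0≤y-x (limit-≤ {φ = λ Y → - 1# * φ Y} {c = - c} approx (Lipschitz-*ˡ (- 1#) φ-lip)
        (λ {Y} feasible → ≤-by (0≤y-x (c≤φ feasible)) (solve 2 (λ c f → :- c := :- :1 :* f :+ (f :- c)) refl c (φ Y)))))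
        (solve 2 (λ c f → f := c :+ (:- c :- :- :1 :* f)) refl c (φ Z))

      limit-≈ : ∀ {Z φ c} → Approximable Z → Lipschitz φ → (∀ {Y} → Feasible Y → φ Y ≈ c) → φ Z ≈ c
      limit-≈ approx φ-lip φ≈c = ≤.antisym (limit-≤ approx φ-lip (≤.reflexive ∘ φ≈c)) (limit-≥ approx φ-lip (≤.reflexive ∘ sym ∘ φ≈c))

      limit-trace : ∀ {Z c} → Approximable Z → (W : Matrix n² n²) → (∀ {Y} → Feasible Y → trace (W *ᴹ Y) ≈ c) → trace (W *ᴹ Z) ≈ c
      limit-trace approx W W≈c = limit-≈ {φ = λ Y → trace (W *ᴹ Y)} approx (Lipschitz-trace W) W≈c

      Feasible-closed : ∀ {Z} → Approximable Z → Feasible Z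
      Feasible-closed {Z} approx = record
        { symmetric            = λ x y → begin-equality
            -- Symmetry is restated as the vanishing of a linear functional, to which the limit
            -- lemma with a constant value applies.
            Z x y                            ≈⟨ solve 2 (λ a b → a := (a :+ :- :1 :* b) :+ b) refl (Z x y) (Z y x) ⟩
            (Z x y + - 1# * Z y x) + Z y x
              ≈⟨ +-congʳ (limit-≈ {φ = λ Y → Y x y + - 1# * Y y x} approx
                   (Lipschitz-+ (Lipschitz-entry x y) (Lipschitz-*ˡ (- 1#) (Lipschitz-entry y x)))
                   (λ {Y} feasible → trans (+-congʳ (Feasible.symmetric feasible x y))
                     (solve 1 (λ a → a :+ :- :1 :* a := :0) refl (Y y x)))) ⟩
            0# + Z y x                       ≈⟨ +-identityˡ _ ⟩
            Z y x                            ∎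
        ; nonnegative          = λ x y → limit-≥ {φ = λ Y → Y x y} approx (Lipschitz-entry x y) (λ feasible → Feasible.nonnegative feasible x y)
        ; positiveSemidefinite = λ x → limit-≥ {φ = λ Y → quadraticForm Y x} approx (Lipschitz-quadraticForm x) (λ feasible → Feasible.positiveSemidefinite feasible x)
        ; trace-I⊗E            = λ j → limit-trace approx (I n ⊗ E j) (λ feasible → Feasible.trace-I⊗E feasible j)
        ; trace-E⊗I            = λ j → limit-trace approx (E j ⊗ I n) (λ feasible → Feasible.trace-E⊗I feasible j)
        ; trace-gangster       = limit-trace approx (I n ⊗ (J n -ᴹ I n) +ᴹ (J n -ᴹ I n) ⊗ I n) Feasible.trace-gangster
        ; trace-J⊗J            = limit-trace approx (J n ⊗ J n) Feasible.trace-J⊗J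
        }
        where open ≤-Reasoning

      private
        coordinate : Fin (n² ℕ.* n²) → Matrix n² n² → Carrier
        coordinate xy Y = Y (quotient n² xy) (remainder {n²} n² xy)

      -- Feasibility and near-optimality sit in one family, so its cluster point is feasible and
      -- reaches the infimum at once.
      NearOptimal : Carrier → Carrier → Matrix n² n² → Set
      NearOptimal v ε Y = Feasible Y × objective Y ≤ v + ε

      Attained : Carrier → Set
      Attained c = ∃[ Y ] Feasible Y × objective Y ≈ c

      IsOPT-exists : ∀ {Y₀} → Feasible Y₀ → ∃[ v ] IsOPT v
      IsOPT-exists {Y₀} Y₀-feasible = optimal (infimum Attained (objective Y₀ , Y₀ , Y₀-feasible , refl)
          (λ c (Y , feasible , obj≈c) → ≤.trans (objective-nonneg (Feasible.nonnegative feasible)) (≤.reflexive obj≈c)))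
        where
        optimal : ∃[ v ] ((∀ c → Attained c → v ≤ c) × (∀ ε → 0# < ε → ∃[ c ] (Attained c × c ≤ v + ε))) → ∃[ v ] IsOPT v
        optimal (v , v≤ , approached) = limit (clusterPoint (NearOptimal v)
            (λ ε≤ε′ (feasible , obj≤) → feasible , ≤.trans obj≤ (+-mono-≤ ≤.refl ε≤ε′))
            (λ ε 0<ε → nearOptimal (approached ε 0<ε))
            coordinate (fromℕ n²)
            (λ (feasible , _) xy → Feasible.nonnegative feasible _ _ , Feasible⇒≤n² feasible _ _))
          where
          nearOptimal : ∀ {ε} → ∃[ c ] (Attained c × c ≤ v + ε) → ∃[ Y ] NearOptimal v ε Y
          nearOptimal (c , (Y , feasible , obj≈c) , c≤) = Y , feasible , ≤.trans (≤.reflexive obj≈c) c≤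
          limit : (∃ λ (z : Vector Carrier (n² ℕ.* n²)) →
                     Inhabited (λ ε Y → NearOptimal v ε Y × (∀ xy → Near ε (coordinate xy Y) (z xy)))) → ∃[ v ] IsOPT v
          limit (z , inhabited) = v , (Z , Z-feasible , ≤.antisym obj≤v (v≤ (objective Z) (Z , Z-feasible , refl))) , v≤
            where
            Z : Matrix n² n²
            Z x y = z (combine x y)
            near : ∀ {ε Y} → (∀ xy → Near ε (coordinate xy Y) (z xy)) → NearMatrix ε Y Z
            near {ε} {Y} all x y = ≡.subst (λ xy → Near ε (Y (proj₁ xy) (proj₂ xy)) (Z x y)) (remQuot-combine x y) (all (combine x y))
            Z-feasible : Feasible Z
            Z-feasible = Feasible-closed λ ε 0<ε →
              let (Y , (feasible , _) , all) = inhabited ε 0<ε in Y , feasible , near all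
            obj≤v : objective Z ≤ v
            obj≤v = Lipschitz-≤-closed {φ = objective} (Lipschitz-trace (submatrix D β β ⊗ (½ *ˢ submatrix (C₁ n) α α) +ᴹ Diag c̄))
              λ ε 0<ε → let (Y , (_ , obj≤) , all) = inhabited ε 0<ε in Y , obj≤ , near all

  -- The integrality gap

  module Instance (em : ExcludedMiddle 0ℓ) (r s : ∀ n → Fin (suc n)) (z : ℕ) (1≤z : 1 ℕ.≤ z) where

    h n : ℕ
    h = z ℕ.* 6
    n = h ℕ.* (h ℕ.+ h)

    private
      6≤h : 6 ℕ.≤ h
      6≤h = ℕ.*-monoˡ-≤ 6 1≤z

      1≤h : 1 ℕ.≤ h
      1≤h = ℕ.≤-trans (ℕ.s≤s ℕ.z≤n) 6≤h

      2≤h : 2 ℕ.≤ h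
      2≤h = ℕ.≤-trans (ℕ.s≤s (ℕ.s≤s ℕ.z≤n)) 6≤h

      1≤2h : 1 ℕ.≤ h ℕ.+ h
      1≤2h = ℕ.≤-trans 1≤h (ℕ.m≤m+n h h)

      2h<n : h ℕ.+ h ℕ.< n
      2h<n = ℕ.<-≤-trans (ℕ.+-monoˡ-≤ (h ℕ.+ h) 1≤2h)
        (ℕ.≤-trans (ℕ.≤-reflexive (≡.cong (h ℕ.+ h ℕ.+_) (≡.sym (ℕ.+-identityʳ (h ℕ.+ h))))) (ℕ.*-monoˡ-≤ (h ℕ.+ h) 2≤h))

      2≤n : 2 ℕ.≤ n
      2≤n = ℕ.≤-trans (ℕ.s≤s 1≤2h) 2h<n

      1≤n : 1 ℕ.≤ n
      1≤n = ℕ.≤-trans (ℕ.s≤s ℕ.z≤n) 2≤n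

      instance
        n-nonZero : NonZero n
        n-nonZero = ℕ.>-nonZero 1≤n

    module H = Hat h 1≤h 2h<n
    module 𝒢 = Groups {h} {h ℕ.+ h} {H.b} (fromℕ-+ h h)

    label : Fin (suc n) → Fin h
    -- The vertex deleted by the program joins group 0; the other vertices already represent every
    -- group.
    label = insertAt 𝒢.group (s n) (fromℕ< 1≤h)

    module L = Labels {n} label

    private
      rₙ sₙ : Fin (suc n)
      rₙ = r n
      sₙ = s n

      η≥1 : 1# ≤ H.η
      η≥1 = ≤.trans (≤.reflexive (sym (+-identityʳ 1#))) (fromℕ-mono-≤ 1≤h)

      0<b-1 : 0# < H.b - 1#
      0<b-1 = <-≤-trans 0<1 (begin
        1#              ≈⟨ solve 0 (:1 := (:1 :+ :1) :- :1) refl ⟩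
        2# - 1#         ≤⟨ +-monoˡ-≤ (- 1#) (+-mono-≤ η≥1 η≥1) ⟩
        H.b - 1#        ∎)
        where open ≤-Reasoning

    open Lift 1≤n 0<b-1 H.0<A 𝒢.G-pattern H.M-pattern
    open Program rₙ sₙ L.D
    open SDP₂ rₙ sₙ L.D

    private
      label-β : ∀ i → label (β i) ≡ 𝒢.group i
      label-β = insertAt-punchIn 𝒢.group sₙ _

      label-surjective : ∀ γ → ∃[ x ] label x ≡ γ
      label-surjective γ = β i , ≡.trans (label-β i) (≡.cong proj₁ (remQuot-combine γ (fromℕ< 1≤2h)))
        where i = combine γ (fromℕ< 1≤2h)

      C[1-M]≤Cδ : ∀ p q → C₁ n (α p) (α q) * (1# - H.M p q) ≤ C₁ n (α p) (α q) * H.δ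
      C[1-M]≤Cδ p q = bound (next (α p) ≟ α q ⊎-dec next (α q) ≟ α p) λ
        { (inj₁ p→q) → H.Adjacent⇒1-M≤δ p q (next-punchIn rₙ p q p→q)
        ; (inj₂ q→p) → ≤.trans (+-mono-≤ ≤.refl (≤.reflexive (-‿cong (IsPattern.symmetric H.M-pattern p q))))
                         (H.Adjacent⇒1-M≤δ q p (next-punchIn rₙ q p q→p)) }
        where
        bound : ∀ {P : Set} (P? : Dec P) {x y} → (P → x ≤ y) → 𝟙 P? * x ≤ 𝟙 P? * y
        bound (yes p) x≤y = *-monoʳ-≤ 0≤1 (x≤y p)
        bound (no _)  _   = ≤.reflexive (trans (zeroˡ _) (sym (zeroˡ _)))

      objective-Y≤6 : objective Y ≤ fromℕ 6
      objective-Y≤6 = begin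
        objective Y
          ≤⟨ objective-Y {H.δ}
               (λ i j → 𝟙-idem (𝒢.group i ≟ 𝒢.group j))
               (λ i j → reflexive (≡.cong₂ (λ a b → 1# - 𝟙 (a ≟ b)) (label-β i) (label-β j)))
               (λ i → L.D≤1 sₙ (β i))
               (λ p → C₁-degree-punchIn rₙ (α p))
               (≤.trans (≤.reflexive (∑-cong λ p → reflexive (C₁-symmetric (α p) rₙ))) (C₁-degree-punchIn rₙ rₙ))
               C₁-nonneg C[1-M]≤Cδ H.0≤δ ⟩
        2# + fromℕ n * H.δ
          ≈⟨ +-congˡ (*-congʳ (trans (fromℕ-* h (h ℕ.+ h)) (*-congˡ (fromℕ-+ h h)))) ⟩
        2# + H.η * (H.η + H.η) * H.δ
          ≈⟨ solve 2 (λ e d → (:1 :+ :1) :+ e :* (e :+ e) :* d := (:1 :+ :1) :+ (e :* e :* d :+ e :* e :* d)) refl H.η H.δ ⟩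
        2# + (H.η * H.η * H.δ + H.η * H.η * H.δ)
          ≤⟨ +-mono-≤ ≤.refl (+-mono-≤ H.ηηδ≤2 H.ηηδ≤2) ⟩
        2# + (2# + 2#)
          ≈⟨ solve 0 (let t = :1 :+ :1 in t :+ (t :+ t) := :1 :+ (:1 :+ (:1 :+ (:1 :+ (:1 :+ (:1 :+ :0)))))) refl ⟩
        fromℕ 6 ∎
        where open ≤-Reasoning

      D-nonneg : Nonnegative L.D
      D-nonneg = IsInstance.nonnegative L.D-isInstance

    open Compactness em
    open Attainment rₙ sₙ L.D D-nonneg

    ratio≥z : ∃[ ρ ] InstanceRatio r s ρ × [ fromℕ z ] ≤⁺ ρ
    ratio≥z = ratio (L.IsOPT-TSP-exists em) (IsOPT-exists Y-feasible)
      where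
      ratio : ∃[ t ] IsOPT-TSP L.D t → ∃[ v ] IsOPT v → ∃[ ρ ] InstanceRatio r s ρ × [ fromℕ z ] ≤⁺ ρ
      ratio (t , t-opt@((σ , σ≈t) , _)) (v , v-opt@((Y* , Y*-feasible , Y*≈v) , v-min)) = conclude em
        where
        6z≤t : fromℕ z * fromℕ 6 ≤ t
        6z≤t = ≤.trans (≤.reflexive (sym (fromℕ-* z 6))) (≤.trans (L.tourCost-≥ 2≤h label-surjective σ) (≤.reflexive σ≈t))
        0<t : 0# < t
        0<t = <-≤-trans (fromℕ-pos 1≤h) (≤.trans (≤.reflexive (fromℕ-* z 6)) 6z≤t)
        v≤6 : v ≤ fromℕ 6
        v≤6 = ≤.trans (v-min (objective Y) (Y , Y-feasible , refl)) objective-Y≤6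
        0≤v : 0# ≤ v
        0≤v = ≤.trans (objective-nonneg (Feasible.nonnegative Y*-feasible)) (≤.reflexive Y*≈v)
        instanceRatio : ∀ {ρ} → IsRatio t v ρ → InstanceRatio r s ρ
        instanceRatio isRatio = record
          { n = n ; 2≤n = 2≤n ; D = L.D ; isInstance = L.D-isInstance
          ; opt-TSP = t ; isOPT-TSP = t-opt ; opt-TSP≉0 = <⇒≉ 0<t
          ; opt-SDP₂ = v ; isOPT-SDP₂ = v-opt ; isRatio = isRatio }
        conclude : Dec (v ≈ 0#) → ∃[ ρ ] InstanceRatio r s ρ × [ fromℕ z ] ≤⁺ ρ
        conclude (yes v≈0) = ⊤⁺ , instanceRatio v≈0 , (_ ≤⊤⁺)
        conclude (no v≉0)  = [ t * v ⁻¹ ] , instanceRatio (v≉0 , qv≈t) , [ *-cancelˡ-≤ 0<v (begin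
          v * fromℕ z         ≈⟨ *-comm _ _ ⟩
          fromℕ z * v         ≤⟨ *-monoʳ-≤ (fromℕ-nonneg z) v≤6 ⟩
          fromℕ z * fromℕ 6   ≤⟨ 6z≤t ⟩
          t                   ≈⟨ trans (*-comm _ _) qv≈t ⟨
          v * (t * v ⁻¹)      ∎) ]≤
          where
          open ≤-Reasoning
          0<v : 0# < v
          0<v = ≤∧≉⇒< 0≤v v≉0
          qv≈t : t * v ⁻¹ * v ≈ t
          qv≈t = trans (*-assoc _ _ _) (trans (*-congˡ (⁻¹-inverseˡ 0<v)) (*-identityʳ t))

  -- Without a finite upper bound the supremum is `⊤⁺`. A finite upper bound excludes `⊤⁺` from P,
  -- so the given member is real and completeness applies to the real part.
  ⁺-supremum : ExcludedMiddle 0ℓ → (P : Carrier ⁺ → Set) → ∃[ ρ ] P ρ → ∃[ σ ] IsSupremum _≤⁺_ P σ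
  ⁺-supremum em P (ρ , Pρ) with em {∃[ q ] IsUpperBound _≤⁺_ P [ q ]}
  ... | no unbounded = ⊤⁺ , (λ x _ → (x ≤⊤⁺)) , λ where
    [ q ] q-ub → ⊥-elim (unbounded (q , q-ub))
    ⊤⁺    _    → _ ≤⊤⁺
  ... | yes (q , q-ub) = finite ρ Pρ
    where
    finite : ∀ ρ → P ρ → ∃[ σ ] IsSupremum _≤⁺_ P σ
    finite ⊤⁺    P⊤ with () ← q-ub ⊤⁺ P⊤
    finite [ x ] Px with complete (λ y → P [ y ]) (x , Px) (q , λ y Py → [≤]-injective (q-ub [ y ] Py))
    ... | σ , σ-ub , σ-least = [ σ ] , ub , least
      where
      ub : IsUpperBound _≤⁺_ P [ σ ]
      ub [ y ] Py = [ σ-ub y Py ]≤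
      ub ⊤⁺    P⊤ with () ← q-ub ⊤⁺ P⊤
      least : ∀ b → IsUpperBound _≤⁺_ P b → [ σ ] ≤⁺ b
      least [ b ] b-ub = [ σ-least b (λ y Py → [≤]-injective (b-ub [ y ] Py)) ]≤
      least ⊤⁺    _    = _ ≤⊤⁺

  gap≥z : ExcludedMiddle 0ℓ → (r s : ∀ n → Fin (suc n)) (z : ℕ) → 1 ℕ.≤ z →
      ∃[ gap ] IsIntegralityGap r s gap × [ fromℕ z ] ≤⁺ gap
  gap≥z em r s z 1≤z =
    let
      (ρ , ρ-ratio , z≤ρ)   = Instance.ratio≥z em r s z 1≤z
      (gap , gap-ub , least) = ⁺-supremum em (InstanceRatio r s) (ρ , ρ-ratio)
    in gap , (gap-ub , least) , ≤⁺-trans ≤.trans z≤ρ (gap-ub ρ ρ-ratio)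

theorem4p1 : ExcludedMiddle 0ℓ → (ℝ : CompleteOrderedField) → let open TSP ℝ in
    (r s : ∀ n → Fin (suc n)) (z : ℕ) → 1 ℕ.≤ z →
    ∃[ gap ] IsIntegralityGap r s gap × [ fromℕ z ] ≤⁺ gap
theorem4p1 em ℝ = Gap.gap≥z ℝ em
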